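{- Let $n\ge1$, let $S=\{a_1^{r_1},\dots,a_m^{r_m}\}$ be a multiset of elements of $[n]$ with $a_1<\dots<a_m$ and multiplicities $r_i\ge1$, and let $T\subseteq[n]$ be a set with $|T|=|S|=r_1+\dots+r_m$. For $1\le i\le m$ let $h(i)=|\{j\in T: j>a_i\}|-|\{j\in S: j>a_i\}|$ (elements of $S$ counted with multiplicity). Let $LP_n(S,T)$ be the set of linked partitions $\pi$ of $[n]$ with $\mathrm{left}(\pi)=S$ and $\mathrm{right}(\pi)=T$. Then $$\sum_{\pi\in LP_n(S,T)}x^{cr_2(\pi)}y^{ne_2(\pi)}=\sum_{\pi\in LP_n(S,T)}x^{ne_2(\pi)}y^{cr_2(\pi)}=\prod_{i=1}^m y^{r_ih(i)-r_i^2}\left.{h(i)\brack r_i}_q\right|_{q=x/y},$$ where ${a\brack b}_q=\frac{(q^a-1)(q^a-q)\cdots(q^a-q^{b-1})}{(q^b-1)(q^b-q)\cdots(q^b-q^{b-1})}$ is the $q$-binomial coefficient (equal to $0$ when $0\le a<b$).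
   Context: Two finite sets of integers $E,F$ are nearly disjoint if for every $i\in E\cap F$ either ($i=\min(E)$, $|E|>1$, $i\ne\min(F)$) or ($i=\min(F)$, $|F|>1$, $i\ne\min(E)$). A linked partition of $[n]$ is a set of nonempty subsets (blocks) of $[n]$ with union $[n]$, any two distinct blocks nearly disjoint. The arcs of a linked partition $\pi$ are the pairs $(i_1,j)$ where $i_1=\min(E)$ and $j\in E\setminus\{i_1\}$ for some block $E$ with $|E|\ge2$. $\mathrm{left}(\pi)$ is the multiset of left endpoints $i_1$ of arcs (one copy per arc) and $\mathrm{right}(\pi)$ the multiset (in fact a set) of right endpoints $j$ of arcs. Two arcs $(i_1,j_1),(i_2,j_2)$ form a 2-crossing if $i_1<i_2<j_1<j_2$ and a 2-nesting if $i_1<i_2<j_2<j_1$; $cr_2(\pi)$ and $ne_2(\pi)$ denote the numbers of 2-crossings and 2-nestings of $\pi$. -}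

module Defs where

open import Level using (suc; _⊔_)
open import Algebra.Bundles using (CommutativeRing; Semiring)
import Algebra.Definitions.RawSemiring as RawSemiringDefs
open import Data.Nat as ℕ using (ℕ)
import Data.Nat.Properties as ℕₚ
open import Data.Integer as ℤ using (ℤ; +_; -[1+_])
open import Data.Bool.Base using (if_then_else_)
import Data.Bool.Properties as Boolₚ
open import Data.Fin using (Fin; toℕ; _<_; _≤_)
open import Data.Fin.Properties using (_≟_; _<?_; _≤?_; all?)
open import Data.Fin.Subset using (Subset; inside; outside; _∈_; _∩_; ∣_∣; Nonempty)
open import Data.Fin.Subset.Properties using (_∈?_; nonempty?)
open import Data.Vec using ([]; _∷_)
import Data.Vec.Properties as Vecₚ
open import Data.List using (List; []; _∷_; _++_; map; filter; foldr; length; allFin; cartesianProduct)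
open import Data.List.Relation.Unary.All as All using (All)
open import Data.List.Relation.Unary.Any as Any using (Any)
open import Data.Product using (_×_; _,_; proj₁; proj₂)
open import Data.Sum using (_⊎_)
open import Relation.Binary.PropositionalEquality using (_≡_; _≢_)
open import Relation.Nullary using (¬_; Dec; does)
open import Relation.Nullary.Decidable using (map′; _×-dec_; _⊎-dec_; _→-dec_; ¬?)

open RawSemiringDefs ℕ.+-*-rawSemiring using () renaming (sum to sumℕ) public

------------------------------------------------------------------------
-- Linked partitions

-- The ground set [n] is Fin n with its usual order.

private
  variable
    n m : ℕ

IsMin : Fin n → Subset n → Set
IsMin i E = i ∈ E × (∀ k → k ∈ E → i ≤ k)

isMin? : (i : Fin n) (E : Subset n) → Dec (IsMin i E)
isMin? i E = (i ∈? E) ×-dec all? (λ k → (k ∈? E) →-dec (i ≤? k))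

NearlyDisjoint : Subset n → Subset n → Set
NearlyDisjoint E F = ∀ i → i ∈ E ∩ F →
    (IsMin i E × 1 ℕ.< ∣ E ∣ × ¬ IsMin i F)
  ⊎ (IsMin i F × 1 ℕ.< ∣ F ∣ × ¬ IsMin i E)

nearlyDisjoint? : (E F : Subset n) → Dec (NearlyDisjoint E F)
nearlyDisjoint? E F = all? λ i → (i ∈? (E ∩ F)) →-dec
  (    (isMin? i E ×-dec (1 ℕ.<? ∣ E ∣) ×-dec ¬? (isMin? i F))
  ⊎-dec (isMin? i F ×-dec (1 ℕ.<? ∣ F ∣) ×-dec ¬? (isMin? i E)))

-- A set of subsets of [n] is represented by a list of subsets; the lists
-- that are used are the sublists of the duplicate-free list allSubsets n,
-- so that each set of subsets is represented exactly once.

record IsLinkedPartition {n} (π : List (Subset n)) : Set where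
  field
    nonempty        : All Nonempty π
    covers          : ∀ i → Any (i ∈_) π
    nearlyDisjoint  : All (λ E → All (λ F → E ≢ F → NearlyDisjoint E F) π) π

isLinkedPartition? : (π : List (Subset n)) → Dec (IsLinkedPartition π)
isLinkedPartition? π = map′
  (λ (a , b , c) → record { nonempty = a ; covers = b ; nearlyDisjoint = c })
  (λ p → let open IsLinkedPartition p in nonempty , covers , nearlyDisjoint)
  (All.all? nonempty? π
    ×-dec all? (λ i → Any.any? (i ∈?_) π)
    ×-dec All.all? (λ E → All.all? (λ F → ¬? (Vecₚ.≡-dec Boolₚ._≟_ E F) →-dec nearlyDisjoint? E F) π) π)

allSubsets : ∀ n → List (Subset n)
allSubsets ℕ.zero    = [] ∷ []
allSubsets (ℕ.suc n) = map (inside ∷_) (allSubsets n) ++ map (outside ∷_) (allSubsets n)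

-- All sublists, one for each subset of the positions.
sublists : ∀ {a} {A : Set a} → List A → List (List A)
sublists []       = [] ∷ []
sublists (x ∷ xs) = map (x ∷_) (sublists xs) ++ sublists xs

------------------------------------------------------------------------
-- Arcs, crossings and nestings

Arc : ℕ → Set
Arc n = Fin n × Fin n

IsArc : List (Subset n) → Arc n → Set
IsArc π (i , j) = Any (λ E → 2 ℕ.≤ ∣ E ∣ × IsMin i E × j ∈ E × j ≢ i) π

isArc? : (π : List (Subset n)) (α : Arc n) → Dec (IsArc π α)
isArc? π (i , j) = Any.any?
  (λ E → (2 ℕ.≤? ∣ E ∣) ×-dec isMin? i E ×-dec (j ∈? E) ×-dec ¬? (j ≟ i)) π

arcs : List (Subset n) → List (Arc n)
arcs {n} π = filter (isArc? π) (cartesianProduct (allFin n) (allFin n))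

Crossing : Arc n × Arc n → Set
Crossing ((i₁ , j₁) , (i₂ , j₂)) = i₁ < i₂ × i₂ < j₁ × j₁ < j₂

crossing? : (p : Arc n × Arc n) → Dec (Crossing p)
crossing? ((i₁ , j₁) , (i₂ , j₂)) = (i₁ <? i₂) ×-dec (i₂ <? j₁) ×-dec (j₁ <? j₂)

Nesting : Arc n × Arc n → Set
Nesting ((i₁ , j₁) , (i₂ , j₂)) = i₁ < i₂ × i₂ < j₂ × j₂ < j₁

nesting? : (p : Arc n × Arc n) → Dec (Nesting p)
nesting? ((i₁ , j₁) , (i₂ , j₂)) = (i₁ <? i₂) ×-dec (i₂ <? j₂) ×-dec (j₂ <? j₁)

-- The condition i₁ < i₂ orders the two arcs, so counting ordered pairs
-- counts each crossing and each nesting once.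

cr₂ : List (Subset n) → ℕ
cr₂ π = length (filter crossing? (cartesianProduct (arcs π) (arcs π)))

ne₂ : List (Subset n) → ℕ
ne₂ π = length (filter nesting? (cartesianProduct (arcs π) (arcs π)))

------------------------------------------------------------------------
-- Multisets of elements of [n], given by their multiplicities

Multiset : ℕ → Set
Multiset n = Fin n → ℕ

_≐_ : Multiset n → Multiset n → Set
M ≐ N = ∀ v → M v ≡ N v

_≐?_ : (M N : Multiset n) → Dec (M ≐ N)
M ≐? N = all? (λ v → M v ℕ.≟ N v)

-- The multiset {a₁^r₁, …, aₘ^rₘ}.
multiset : (Fin m → Fin n) → (Fin m → ℕ) → Multiset n
multiset a r v = sumℕ (λ i → if does (a i ≟ v) then r i else 0)

asMultiset : Subset n → Multiset n
asMultiset T v = if does (v ∈? T) then 1 else 0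

-- The number of elements greater than v, with multiplicity.
above : Fin n → Multiset n → ℕ
above v M = sumℕ (λ j → if does (v <? j) then M j else 0)

left : List (Subset n) → Multiset n
left π v = length (filter (λ α → proj₁ α ≟ v) (arcs π))

right : List (Subset n) → Multiset n
right π v = length (filter (λ α → proj₂ α ≟ v) (arcs π))

LP : ∀ n → Multiset n → Subset n → List (List (Subset n))
LP n S T = filter
  (λ π → isLinkedPartition? π ×-dec (left π ≐? S) ×-dec (right π ≐? asMultiset T))
  (sublists (allSubsets n))

height : (S : Multiset n) (T : Subset n) → Fin n → ℤ
height S T v = + above v (asMultiset T) ℤ.- + above v S

------------------------------------------------------------------------
-- The ring in which the identity takes place

-- A commutative ring with elements x, y for which the right-hand side
-- makes sense: x and y are units (h(i) may be negative), and so are the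
-- denominators of the q-binomial coefficients at q = x/y.  The case of
-- indeterminates is ℚ(x,y), or its subring obtained from ℤ[x,y] by
-- inverting x, y and all xᵏ - yᵏ with k ≥ 1, which is the initial instance.

module _ {c ℓ} (K : CommutativeRing c ℓ) where
  open CommutativeRing K
  open RawSemiringDefs (Semiring.rawSemiring semiring) using (product; _^_)

  -- ∏_{j<b} (u - qʲ): the numerator of [a b]_q for u = qᵃ, its denominator
  -- for u = q^b.
  falling : (q u : Carrier) → ℕ → Carrier
  falling q u b = product {b} (λ j → u - q ^ toℕ j)

  integerPower : (u u⁻¹ : Carrier) → ℤ → Carrier
  integerPower u u⁻¹ (+ k)      = u ^ k
  integerPower u u⁻¹ (-[1+ k ]) = u⁻¹ ^ ℕ.suc k

record Indeterminates c ℓ : Set (suc (c ⊔ ℓ)) where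
  field
    commutativeRing : CommutativeRing c ℓ

  open CommutativeRing commutativeRing public
  open RawSemiringDefs (Semiring.rawSemiring semiring) public using (product; _^_)

  field
    x y x⁻¹ y⁻¹ : Carrier
    x-inverse   : x * x⁻¹ ≈ 1#
    y-inverse   : y * y⁻¹ ≈ 1#

  q : Carrier
  q = x * y⁻¹

  field
    denominator⁻¹       : ℕ → Carrier
    denominator-inverse : ∀ b → falling commutativeRing q (q ^ b) b * denominator⁻¹ b ≈ 1#

  q⁻¹ : Carrier
  q⁻¹ = y * x⁻¹

  q^ : ℤ → Carrier
  q^ = integerPower commutativeRing q q⁻¹

  y^ : ℤ → Carrier
  y^ = integerPower commutativeRing y y⁻¹

  qBinomial : ℤ → ℕ → Carrier
  qBinomial a b = falling commutativeRing q (q^ a) b * denominator⁻¹ b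

  sumOver : ∀ {a} {A : Set a} → List A → (A → Carrier) → Carrier
  sumOver L f = foldr _+_ 0# (map f L)

{-# OPTIONS --safe #-}
-- A linked partition is determined by its arcs, and the sets of arcs that occur are those in
-- which every vertex has at most one incoming arc. Read the left endpoints from right to left:
-- when a_i is reached, h(i) right endpoints to its right are still unused, r_i of them become its
-- children, and the unused ones will be joined to smaller left endpoints. Hence a pair of an
-- unused and a chosen endpoint is exactly one crossing or nesting, according to its order, and
-- the choice at a_i contributes the generating function of r_i-subsets of an h(i)-set, which is
-- a homogeneous Gaussian binomial coefficient, whatever was chosen before.
module Submission where

open import Defs
open import Level using (_⊔_)
open import Algebra.Bundles using (CommutativeMonoid)
import Algebra.Properties.CommutativeMonoid.Sum as CommutativeMonoidSum
import Algebra.Properties.CommutativeSemiring.Exp as Exp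
import Algebra.Properties.Monoid.Sum as MonoidSum
import Algebra.Properties.Ring as RingProperties
import Algebra.Properties.Semiring.Sum as SemiringSum
import Algebra.Solver.Ring.NaturalCoefficients.Default as CommutativeSemiringSolver
open import Data.Bool using (Bool; true; false; if_then_else_; _∧_; _∨_)
import Data.Bool.Properties as Boolₚ
open import Data.Nat as ℕ using (ℕ; zero; suc)
open import Data.Nat.ListAction.Properties using (sum-++)
import Data.Nat.Properties as ℕₚ
open import Data.Nat.Solver using (module +-*-Solver)
open import Data.Integer as ℤ using (ℤ; +_)
import Data.Integer.Properties as ℤₚ
open import Data.Fin as Fin using (Fin; zero; suc; toℕ; fromℕ<; _<_)
open import Data.Fin.Properties
  using (_≟_; _<?_; all?; any?; toℕ-fromℕ<; <-cmp; <-trans; <⇒≢; ≤-refl; ≤-antisym; ≤∧≢⇒<)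
open import Data.Fin.Subset using (Subset; inside; outside; _∈_; _∪_; ⁅_⁆; ⊥; ∣_∣; Nonempty)
open import Data.Fin.Subset.Properties
  using (_∈?_; x∈⁅x⁆; ∣⁅x⁆∣≡1; ∣⊥∣≡0; x∈p∩q⁺; x∈p∩q⁻; ⊆-antisym; p⊆q⇒∣p∣≤∣q∣; x∈p⇒∣p-x∣<∣p∣; x∈p∧x≢y⇒x∈p-y)
open import Data.List using (List; []; _∷_; [_]; _++_; map; concatMap; filter; length; allFin; cartesianProduct)
import Data.List as List
open import Data.List.Membership.Propositional using (find; lose) renaming (_∈_ to _∈ˡ_)
open import Data.List.Membership.Propositional.Properties
  using (∈-map⁺; ∈-map⁻; ∈-++⁺ˡ; ∈-++⁺ʳ; ∈-++⁻; ∈-concatMap⁺; ∈-concatMap⁻; ∈-filter⁺; ∈-filter⁻)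
open import Data.List.Membership.Propositional.Properties.WithK using (unique∧set⇒bag)
open import Data.List.Properties using (map-++; map-∘; map-cong; map-tabulate; filter-accept; filter-reject)
open import Data.List.Relation.Binary.BagAndSetEquality using (∼bag⇒↭)
open import Data.List.Relation.Binary.Disjoint.Propositional using (Disjoint)
open import Data.List.Relation.Binary.Permutation.Propositional as ↭ using (_↭_)
open import Data.List.Relation.Unary.All as All using ([]; _∷_)
import Data.List.Relation.Unary.All.Properties as Allₚ
open import Data.List.Relation.Unary.AllPairs as AllPairs using ([]; _∷_)
import Data.List.Relation.Unary.AllPairs.Properties as AllPairsₚ
open import Data.List.Relation.Unary.Any using (Any; here; there)
open import Data.List.Relation.Unary.Unique.Propositional using (Unique)
import Data.List.Relation.Unary.Unique.Propositional.Properties as Uniqueₚ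
open import Data.Product using (∃; _×_; _,_; proj₁; proj₂)
open import Data.Sum using (_⊎_; inj₁; inj₂)
open import Data.Vec using ([]; _∷_; lookup; tabulate; here; there)
import Data.Vec.Properties as Vecₚ
open import Function using (_∘_; id; mk⇔)
open import Relation.Binary.Core using (_Preserves_⟶_)
open import Relation.Binary.Definitions using (tri<; tri≈; tri>)
open import Relation.Binary.PropositionalEquality as ≡ using (_≡_; _≢_)
import Relation.Binary.Reasoning.Setoid as SetoidReasoning
open import Relation.Nullary using (¬_; does; yes; no; contradiction)
open import Relation.Nullary.Decidable using (dec-true; dec-false; _×-dec_; _⊎-dec_; ¬?; decidable-stable)
open import Relation.Unary using (Pred; Decidable)

-- Gaussian binomial coefficients

exponent : ∀ r s → + r ℤ.* + (r ℕ.+ s) ℤ.- + (r ℕ.* r) ≡ + (r ℕ.* s)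
exponent r s = begin
  + r ℤ.* + (r ℕ.+ s) ℤ.- + (r ℕ.* r)                ≡⟨ ≡.cong (ℤ._- + (r ℕ.* r)) (ℤₚ.pos-* r (r ℕ.+ s)) ⟨
  + (r ℕ.* (r ℕ.+ s)) ℤ.- + (r ℕ.* r)                ≡⟨ ℤₚ.m-n≡m⊖n (r ℕ.* (r ℕ.+ s)) (r ℕ.* r) ⟩
  r ℕ.* (r ℕ.+ s) ℤ.⊖ (r ℕ.* r)                      ≡⟨ ≡.cong (ℤ._⊖ (r ℕ.* r)) (ℕₚ.*-distribˡ-+ r r s) ⟩
  (r ℕ.* r ℕ.+ r ℕ.* s) ℤ.⊖ (r ℕ.* r)                ≡⟨ ℤₚ.⊖-≥ (ℕₚ.m≤m+n (r ℕ.* r) (r ℕ.* s)) ⟩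
  + ((r ℕ.* r ℕ.+ r ℕ.* s) ℕ.∸ r ℕ.* r)              ≡⟨ ≡.cong +_ (ℕₚ.m+n∸m≡n (r ℕ.* r) (r ℕ.* s)) ⟩
  + (r ℕ.* s)                                        ∎
  where open ≡.≡-Reasoning

module GaussianBinomials {c ℓ} (R : Indeterminates c ℓ) where
  open Indeterminates R
  open Exp commutativeSemiring using (^-congˡ; ^-homo-*; ^-distrib-*)
  open MonoidSum *-monoid using () renaming (sum-cong-≋ to product-cong)
  open RingProperties ring using (x[y-z]≈xy-xz; [y-z]x≈yx-zx)
  open CommutativeSemiringSolver commutativeSemiring using (solve; _:+_; _:*_; _:=_)
  open SetoidReasoning setoid

  fall : ℕ → ℕ → Carrier
  fall h = falling commutativeRing q (q ^ h)

  telescope : ∀ a b c → (a - b) + (b - c) ≈ a - c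
  telescope a b c = begin
    (a - b) + (b - c)       ≈⟨ +-assoc a (- b) (b - c) ⟩
    a + (- b + (b - c))     ≈⟨ +-congˡ (+-assoc (- b) b (- c)) ⟨
    a + ((- b + b) - c)     ≈⟨ +-congˡ (+-congʳ (-‿inverseˡ b)) ⟩
    a + (0# - c)            ≈⟨ +-congˡ (+-identityˡ (- c)) ⟩
    a - c                   ∎

  product-snoc : ∀ (f : ℕ → Carrier) b → product {suc b} (f ∘ toℕ) ≈ product {b} (f ∘ toℕ) * f b
  product-snoc f zero    = *-comm (f 0) 1#
  product-snoc f (suc b) = begin
    f 0 * product {suc b} (f ∘ suc ∘ toℕ)               ≈⟨ *-congˡ (product-snoc (f ∘ suc) b) ⟩
    f 0 * (product {b} (f ∘ suc ∘ toℕ) * f (suc b))     ≈⟨ *-assoc _ _ _ ⟨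
    f 0 * product {b} (f ∘ suc ∘ toℕ) * f (suc b)       ∎

  product-scale : ∀ a {b} (f : Fin b → Carrier) → product (λ j → a * f j) ≈ a ^ b * product f
  product-scale a {zero}  f = sym (*-identityˡ 1#)
  product-scale a {suc b} f = begin
    a * f Fin.zero * product (λ j → a * f (Fin.suc j))     ≈⟨ *-congˡ (product-scale a (f ∘ Fin.suc)) ⟩
    a * f Fin.zero * (a ^ b * product (f ∘ Fin.suc))
      ≈⟨ solve 4 (λ a x p y → a :* x :* (p :* y) := a :* p :* (x :* y)) refl a (f Fin.zero) (a ^ b) _ ⟩
    a * a ^ b * (f Fin.zero * product (f ∘ Fin.suc))       ∎

  product-zero : ∀ {b} (f : Fin b → Carrier) i → f i ≈ 0# → product f ≈ 0#
  product-zero f Fin.zero    fi≈0 = trans (*-congʳ fi≈0) (zeroˡ _)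
  product-zero f (Fin.suc i) fi≈0 = trans (*-congˡ (product-zero (f ∘ Fin.suc) i fi≈0)) (zeroʳ _)

  fall-snoc : ∀ h r → fall h (suc r) ≈ fall h r * (q ^ h - q ^ r)
  fall-snoc h = product-snoc (λ j → q ^ h - q ^ j)

  -- The factor at j = 0 is split off, and each of the r remaining factors releases one `q`.
  fall-shift : ∀ h r → fall (suc h) (suc r) ≈ (q ^ suc h - 1#) * (q ^ r * fall h r)
  fall-shift h r = *-congˡ (begin
    product {r} (λ j → q * q ^ h - q * q ^ toℕ j)    ≈⟨ product-cong {r} (λ j → sym (x[y-z]≈xy-xz q (q ^ h) (q ^ toℕ j))) ⟩
    product {r} (λ j → q * (q ^ h - q ^ toℕ j))      ≈⟨ product-scale q {r} _ ⟩
    q ^ r * fall h r                                 ∎)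

  fall-zero : ∀ {h r} → h ℕ.< r → fall h r ≈ 0#
  fall-zero {h} {r} h<r = product-zero (λ j → q ^ h - q ^ toℕ j) (fromℕ< h<r) (begin
    q ^ h - q ^ toℕ (fromℕ< h<r)   ≡⟨ ≡.cong (λ k → q ^ h - q ^ k) (toℕ-fromℕ< h<r) ⟩
    q ^ h - q ^ h                  ≈⟨ -‿inverseʳ (q ^ h) ⟩
    0#                             ∎)

  -- The generating function of the r-subsets of a chain of r + s elements: the smallest
  -- element is left out (and then precedes all r chosen ones) or is chosen.
  gauss : (u v : Carrier) → ℕ → ℕ → Carrier
  gauss u v zero    s       = 1#
  gauss u v (suc r) zero    = 1#
  gauss u v (suc r) (suc s) = u ^ suc r * gauss u v (suc r) s + v ^ suc s * gauss u v r (suc s)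

  -- The Gaussian binomial with its denominator cleared. In this form the induction needs no
  -- division, and `denominator⁻¹` enters only afterwards, in `gauss≈factor`.
  ProductFormula : (u v : Carrier) → ℕ → ℕ → Set ℓ
  ProductFormula u v r s = gauss u v r s * fall r r ≈ y ^ (r ℕ.* s) * fall (r ℕ.+ s) r

  -- The coefficients α and β are powers of q, and the last field is one of the two q-Pascal
  -- rules, divided by the common factor of its terms.
  record PascalWeights (u v : Carrier) (r s : ℕ) : Set (c ⊔ ℓ) where
    field
      {α β}   : Carrier
      u-power : u ^ suc r ≈ α * y ^ suc r
      v-power : v ^ suc s ≈ β * y ^ suc s
      pascal  : α * (q ^ (r ℕ.+ suc s) - q ^ r) + β * ((q ^ suc r - 1#) * q ^ r)
                  ≈ (q ^ suc (r ℕ.+ suc s) - 1#) * q ^ r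

  -- Induction along the recursion of `gauss`. Once the denominator is multiplied in, both summands
  -- contain `y ^ (suc r * suc s)` and `fall (r + suc s) r`; what remains after factoring these out
  -- is the field `pascal`.
  productFormula : ∀ {u v} → (∀ r s → PascalWeights u v r s) → ∀ r s → ProductFormula u v r s
  productFormula w zero    s    = refl
  productFormula w (suc r) zero = *-cong (reflexive (≡.cong (y ^_) (≡.sym (ℕₚ.*-zeroʳ r))))
                                         (reflexive (≡.cong (λ k → fall (suc k) (suc r)) (≡.sym (ℕₚ.+-identityʳ r))))
  productFormula {u} {v} w (suc r) (suc s) = begin
    (u ^ suc r * G₁ + v ^ suc s * G₂) * den′
      ≈⟨ solve 5 (λ u a v b d → (u :* a :+ v :* b) :* d := u :* (a :* d) :+ v :* (b :* d)) refl _ _ _ _ _ ⟩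
    u ^ suc r * (G₁ * den′) + v ^ suc s * (G₂ * den′)
      -- The first induction hypothesis consumes `den′` whole. For the second, which has `r` in
      -- place of `suc r`, `den′` is shortened to `fall r r` by `fall-shift`.
      ≈⟨ +-cong (*-cong u-power (trans (productFormula w (suc r) s) (*-congˡ fall₁)))
                (*-cong v-power (*-congˡ (fall-shift r r))) ⟩
    α * y ^ suc r * (y ^ (suc r ℕ.* s) * (N * (q ^ h - q ^ r))) + β * y ^ suc s * (G₂ * ((q ^ suc r - 1#) * (q ^ r * fall r r)))
      ≈⟨ +-congˡ (solve 5 (λ b g m p d → b :* (g :* (m :* (p :* d))) := b :* (m :* p) :* (g :* d)) refl _ _ _ _ _) ⟩
    α * y ^ suc r * (y ^ (suc r ℕ.* s) * (N * (q ^ h - q ^ r))) + β * y ^ suc s * ((q ^ suc r - 1#) * q ^ r) * (G₂ * fall r r)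
      ≈⟨ +-congˡ (*-congˡ (productFormula w r (suc s))) ⟩
    α * y ^ suc r * (y ^ (suc r ℕ.* s) * (N * (q ^ h - q ^ r))) + β * y ^ suc s * ((q ^ suc r - 1#) * q ^ r) * (y ^ (r ℕ.* suc s) * N)
      ≈⟨ solve 9 (λ a y₁ z₁ n d b y₂ z₂ e → a :* y₁ :* (z₁ :* (n :* d)) :+ b :* y₂ :* e :* (z₂ :* n)
                    := n :* (y₁ :* z₁ :* (a :* d) :+ y₂ :* z₂ :* (b :* e))) refl _ _ _ _ _ _ _ _ _ ⟩
    N * (y ^ suc r * y ^ (suc r ℕ.* s) * (α * (q ^ h - q ^ r)) + y ^ suc s * y ^ (r ℕ.* suc s) * (β * ((q ^ suc r - 1#) * q ^ r)))
      ≈⟨ *-congˡ (+-cong (*-congʳ Y₁) (*-congʳ (^-homo-* y (suc s) (r ℕ.* suc s)))) ⟨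
    N * (Y * (α * (q ^ h - q ^ r)) + Y * (β * ((q ^ suc r - 1#) * q ^ r)))
      ≈⟨ *-congˡ (distribˡ Y _ _) ⟨
    N * (Y * (α * (q ^ h - q ^ r) + β * ((q ^ suc r - 1#) * q ^ r)))
      ≈⟨ *-congˡ (*-congˡ pascal) ⟩
    N * (Y * ((q ^ suc h - 1#) * q ^ r))
      ≈⟨ solve 4 (λ n y a p → n :* (y :* (a :* p)) := y :* (a :* (p :* n))) refl _ _ _ _ ⟩
    Y * ((q ^ suc h - 1#) * (q ^ r * N))
      ≈⟨ *-congˡ (fall-shift h r) ⟨
    Y * fall (suc h) (suc r) ∎
    where
    open PascalWeights (w r s)
    h    = r ℕ.+ suc s
    G₁   = gauss u v (suc r) s
    G₂   = gauss u v r (suc s)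
    den′ = fall (suc r) (suc r)
    N    = fall h r
    Y    = y ^ (suc r ℕ.* suc s)
    fall₁ : fall (suc r ℕ.+ s) (suc r) ≈ N * (q ^ h - q ^ r)
    fall₁ = trans (reflexive (≡.cong (λ k → fall k (suc r)) (≡.sym (ℕₚ.+-suc r s)))) (fall-snoc h r)
    Y₁ : Y ≈ y ^ suc r * y ^ (suc r ℕ.* s)
    Y₁ = trans (reflexive (≡.cong (y ^_) (ℕₚ.*-suc (suc r) s))) (^-homo-* y (suc r) (suc r ℕ.* s))

  x^-via-q : ∀ k → x ^ k ≈ q ^ k * y ^ k
  x^-via-q k = trans (^-congˡ k x≈qy) (^-distrib-* q y k)
    where
    x≈qy : x ≈ q * y
    x≈qy = begin
      x                ≈⟨ *-identityʳ x ⟨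
      x * 1#           ≈⟨ *-congˡ y-inverse ⟨
      x * (y * y⁻¹)    ≈⟨ solve 3 (λ x y z → x :* (y :* z) := x :* z :* y) refl x y y⁻¹ ⟩
      q * y            ∎

  -- Here α = q^(r+1) and β = 1: the rule [h+1, r+1] = q^(r+1) [h, r+1] + [h, r] with h = r + s + 1.
  xy-weights : ∀ r s → PascalWeights x y r s
  xy-weights r s = record
    { u-power = x^-via-q (suc r)
    ; v-power = sym (*-identityˡ (y ^ suc s))
    ; pascal  = begin
        q ^ suc r * (Q - p) + 1# * ((q ^ suc r - 1#) * p)
          ≈⟨ +-cong (x[y-z]≈xy-xz (q ^ suc r) Q p) (trans (*-identityˡ _) ([y-z]x≈yx-zx p (q ^ suc r) 1#)) ⟩
        (q ^ suc r * Q - q ^ suc r * p) + (q ^ suc r * p - 1# * p)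
          ≈⟨ telescope _ _ _ ⟩
        q * p * Q - 1# * p
          ≈⟨ +-congʳ (solve 3 (λ q p Q → q :* p :* Q := q :* Q :* p) refl q p Q) ⟩
        q * Q * p - 1# * p
          ≈⟨ [y-z]x≈yx-zx p (q * Q) 1# ⟨
        (q * Q - 1#) * p ∎
    }
    where
    p = q ^ r
    Q = q ^ (r ℕ.+ suc s)

  -- The other q-Pascal rule, with α = 1 and β = q^(s+1) = q^(h-r): [h+1, r+1] = [h, r+1] + q^(h-r)
  -- [h, r].
  yx-weights : ∀ r s → PascalWeights y x r s
  yx-weights r s = record
    { u-power = sym (*-identityˡ (y ^ suc r))
    ; v-power = x^-via-q (suc s)
    ; pascal  = begin
        1# * (Q - p) + t * ((q * p - 1#) * p)
          ≈⟨ +-cong (*-identityˡ _) (trans (*-congˡ ([y-z]x≈yx-zx p (q * p) 1#)) (x[y-z]≈xy-xz t _ _)) ⟩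
        (Q - p) + (t * (q * p * p) - t * (1# * p))
          ≈⟨ +-comm _ _ ⟩
        (t * (q * p * p) - t * (1# * p)) + (Q - p)
          ≈⟨ +-cong (+-cong (solve 3 (λ q p t → t :* (q :* p :* p) := q :* (p :* t) :* p) refl q p t)
                            (-‿cong (trans (*-congˡ (*-identityˡ p)) (*-comm t p))))
                    (+-cong Q≈pt (-‿cong (sym (*-identityˡ p)))) ⟩
        (q * (p * t) * p - p * t) + (p * t - 1# * p)
          ≈⟨ telescope _ _ _ ⟩
        q * (p * t) * p - 1# * p
          ≈⟨ [y-z]x≈yx-zx p _ 1# ⟨
        (q * (p * t) - 1#) * p
          ≈⟨ *-congʳ (+-congʳ (*-congˡ Q≈pt)) ⟨
        (q * Q - 1#) * p ∎
    }
    where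
    p = q ^ r
    t = q ^ suc s
    Q = q ^ (r ℕ.+ suc s)
    Q≈pt : Q ≈ p * t
    Q≈pt = ^-homo-* q r (suc s)

  factor : ℤ → ℕ → Carrier
  factor h r = y^ (+ r ℤ.* h ℤ.- + (r ℕ.* r)) * qBinomial h r

  factor-zero : ∀ {h r} → h ℕ.< r → factor (+ h) r ≈ 0#
  factor-zero h<r = trans (*-congˡ (trans (*-congʳ (fall-zero h<r)) (zeroˡ _))) (zeroʳ _)

  -- A vertex that is not a left endpoint contributes 1 for every integer `h`, also a negative one.
  -- This allows the product over the a_i to be extended to all vertices, over which the induction
  -- runs.
  factor-empty : ∀ h → factor h 0 ≈ 1#
  factor-empty h = begin
    y^ (+ 0 ℤ.* h ℤ.- + 0) * qBinomial h 0   ≡⟨ ≡.cong (λ k → y^ (k ℤ.- + 0) * qBinomial h 0) (ℤₚ.*-zeroˡ h) ⟩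
    1# * (1# * denominator⁻¹ 0)              ≈⟨ *-identityˡ _ ⟩
    1# * denominator⁻¹ 0                     ≈⟨ denominator-inverse 0 ⟩
    1#                                       ∎

  gauss≈factor : ∀ {u v} → (∀ r s → PascalWeights u v r s) → ∀ r s → gauss u v r s ≈ factor (+ (r ℕ.+ s)) r
  gauss≈factor {u} {v} w r s = begin
    gauss u v r s                                                     ≈⟨ *-identityʳ _ ⟨
    gauss u v r s * 1#                                                ≈⟨ *-congˡ (denominator-inverse r) ⟨
    gauss u v r s * (fall r r * denominator⁻¹ r)                      ≈⟨ *-assoc _ _ _ ⟨
    gauss u v r s * fall r r * denominator⁻¹ r                        ≈⟨ *-congʳ (productFormula w r s) ⟩
    y ^ (r ℕ.* s) * fall (r ℕ.+ s) r * denominator⁻¹ r                ≈⟨ *-assoc _ _ _ ⟩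
    y ^ (r ℕ.* s) * qBinomial (+ (r ℕ.+ s)) r                         ≡⟨ ≡.cong (λ k → y^ k * qBinomial (+ (r ℕ.+ s)) r) (exponent r s) ⟨
    factor (+ (r ℕ.+ s)) r                                            ∎

-- Partial arc diagrams

module PartialDiagrams where
  open ≡ using (refl; sym; trans; cong; cong₂; subst; module ≡-Reasoning)
  open ≡-Reasoning
  open CommutativeMonoidSum ℕₚ.+-0-commutativeMonoid using (sum-cong-≗; sum-replicate-zero)

  bit : Bool → ℕ
  bit b = if b then 1 else 0

  bit-injective : ∀ {a b} → bit a ≡ bit b → a ≡ b
  bit-injective {false} {false} _ = refl
  bit-injective {true}  {true}  _ = refl

  indicator : ∀ {n} → Subset n → Fin n → ℕ
  indicator p j = bit (lookup p j)

  sum-indicator : ∀ {n} (p : Subset n) → sumℕ (indicator p) ≡ ∣ p ∣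
  sum-indicator []            = refl
  sum-indicator (outside ∷ p) = sum-indicator p
  sum-indicator (inside ∷ p)  = cong suc (sum-indicator p)

  sum-zeros : ∀ {n} {f : Fin n → ℕ} → (∀ i → f i ≡ 0) → sumℕ f ≡ 0
  sum-zeros {n} f≡0 = trans (sum-cong-≗ f≡0) (sum-replicate-zero n)

  data Split : ∀ {n} → Subset n → ℕ → Subset n → Subset n → Set where
    []    : Split [] 0 [] []
    skip  : ∀ {n r} {U C V : Subset n} → Split U r C V → Split (outside ∷ U) r (outside ∷ C) (outside ∷ V)
    leave : ∀ {n r} {U C V : Subset n} → Split U r C V → Split (inside ∷ U) r (outside ∷ C) (inside ∷ V)
    take  : ∀ {n r} {U C V : Subset n} → Split U r C V → Split (inside ∷ U) (suc r) (inside ∷ C) (outside ∷ V)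

  split-∣∣ : ∀ {n r} {U C V : Subset n} → Split U r C V → ∣ C ∣ ≡ r
  split-∣∣ []        = refl
  split-∣∣ (skip σ)  = split-∣∣ σ
  split-∣∣ (leave σ) = split-∣∣ σ
  split-∣∣ (take σ)  = cong suc (split-∣∣ σ)

  split-indicator : ∀ {n r} {U C V : Subset n} → Split U r C V → ∀ j → indicator C j ℕ.+ indicator V j ≡ indicator U j
  split-indicator (skip σ)  zero    = refl
  split-indicator (leave σ) zero    = refl
  split-indicator (take σ)  zero    = refl
  split-indicator (skip σ)  (suc j) = split-indicator σ j
  split-indicator (leave σ) (suc j) = split-indicator σ j
  split-indicator (take σ)  (suc j) = split-indicator σ j

  split-rest : ∀ {n r} {U C V : Subset n} → Split U r C V → r ℕ.+ ∣ V ∣ ≡ ∣ U ∣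
  split-rest             []        = refl
  split-rest             (skip σ)  = split-rest σ
  split-rest {r = r}     (leave σ) = trans (ℕₚ.+-suc r _) (cong suc (split-rest σ))
  split-rest             (take σ)  = cong suc (split-rest σ)

  split-sizes : ∀ {n r} {U C V : Subset n} → Split U r C V → ∣ U ∣ ≡ ∣ C ∣ ℕ.+ ∣ V ∣
  split-sizes {V = V} σ = trans (sym (split-rest σ)) (cong (ℕ._+ ∣ V ∣) (sym (split-∣∣ σ)))

  split-whole : ∀ {n r} {U C V : Subset n} → Split U r C V → C ∪ V ≡ U
  split-whole []        = refl
  split-whole (skip σ)  = cong (outside ∷_) (split-whole σ)
  split-whole (leave σ) = cong (inside ∷_) (split-whole σ)
  split-whole (take σ)  = cong (inside ∷_) (split-whole σ)

  -- The truncated subtraction is exact: `bit a` is 1 only for `take`, where the count is a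
  -- successor. Later inductions thereby treat the three constructors uniformly.
  split-tail : ∀ {n r u a v} {U C V : Subset n} → Split (u ∷ U) r (a ∷ C) (v ∷ V) → Split U (r ℕ.∸ bit a) C V
  split-tail (skip σ)  = σ
  split-tail (leave σ) = σ
  split-tail (take σ)  = σ

  disjoint⇒split : ∀ {n} (C V : Subset n) → (∀ j → indicator C j ℕ.+ indicator V j ℕ.≤ 1) → Split (C ∪ V) ∣ C ∣ C V
  disjoint⇒split []            []            d = []
  disjoint⇒split (outside ∷ C) (outside ∷ V) d = skip (disjoint⇒split C V (d ∘ suc))
  disjoint⇒split (outside ∷ C) (inside ∷ V)  d = leave (disjoint⇒split C V (d ∘ suc))
  disjoint⇒split (inside ∷ C)  (outside ∷ V) d = take (disjoint⇒split C V (d ∘ suc))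
  disjoint⇒split (inside ∷ C)  (inside ∷ V)  d with ℕ.s≤s () ← d zero

  skips leaves takes : ∀ {n} → Subset n × Subset n → Subset (suc n) × Subset (suc n)
  skips  (C , V) = outside ∷ C , outside ∷ V
  leaves (C , V) = outside ∷ C , inside ∷ V
  takes  (C , V) = inside ∷ C , outside ∷ V

  splits : ∀ {n} → Subset n → ℕ → List (Subset n × Subset n)
  splits []            zero    = [ [] , [] ]
  splits []            (suc r) = []
  splits (outside ∷ U) r       = map skips (splits U r)
  splits (inside ∷ U)  zero    = map leaves (splits U zero)
  splits (inside ∷ U)  (suc r) = map leaves (splits U (suc r)) ++ map takes (splits U r)

  ∈-splits⁻ : ∀ {n} (U : Subset n) r {C V} → (C , V) ∈ˡ splits U r → Split U r C V
  ∈-splits⁻ []            zero    (here refl) = []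
  ∈-splits⁻ (outside ∷ U) r       p with _ , p′ , refl ← ∈-map⁻ skips p = skip (∈-splits⁻ U r p′)
  ∈-splits⁻ (inside ∷ U)  zero    p with _ , p′ , refl ← ∈-map⁻ leaves p = leave (∈-splits⁻ U zero p′)
  ∈-splits⁻ (inside ∷ U)  (suc r) p with ∈-++⁻ (map leaves (splits U (suc r))) p
  ... | inj₁ p₁ with _ , p′ , refl ← ∈-map⁻ leaves p₁ = leave (∈-splits⁻ U (suc r) p′)
  ... | inj₂ p₂ with _ , p′ , refl ← ∈-map⁻ takes p₂  = take (∈-splits⁻ U r p′)

  ∈-splits⁺ : ∀ {n r} {U C V : Subset n} → Split U r C V → (C , V) ∈ˡ splits U r
  ∈-splits⁺ []                                = here refl
  ∈-splits⁺ (skip σ)                          = ∈-map⁺ skips (∈-splits⁺ σ)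
  ∈-splits⁺ {r = zero}          (leave σ)     = ∈-map⁺ leaves (∈-splits⁺ σ)
  ∈-splits⁺ {r = suc r}         (leave σ)     = ∈-++⁺ˡ (∈-map⁺ leaves (∈-splits⁺ σ))
  ∈-splits⁺ {U = inside ∷ U}    (take {r = r} σ) =
    ∈-++⁺ʳ (map leaves (splits U (suc r))) (∈-map⁺ takes (∈-splits⁺ σ))

  splits-unique : ∀ {n} (U : Subset n) r → Unique (splits U r)
  splits-unique []            zero    = All.[] ∷ []
  splits-unique []            (suc r) = []
  splits-unique (outside ∷ U) r       = Uniqueₚ.map⁺ (λ { refl → refl }) (splits-unique U r)
  splits-unique (inside ∷ U)  zero    = Uniqueₚ.map⁺ (λ { refl → refl }) (splits-unique U zero)
  splits-unique (inside ∷ U)  (suc r) = Uniqueₚ.++⁺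
    (Uniqueₚ.map⁺ (λ { refl → refl }) (splits-unique U (suc r)))
    (Uniqueₚ.map⁺ (λ { refl → refl }) (splits-unique U r))
    λ (p , p′) → disjoint (∈-map⁻ leaves p) (∈-map⁻ takes p′)
    where
    disjoint : ∀ {v xs ys} → ∃ (λ x → x ∈ˡ xs × v ≡ leaves x) → ∃ (λ y → y ∈ˡ ys × v ≡ takes y) → _
    disjoint (_ , _ , refl) (_ , _ , ())

  splits-empty : ∀ {n} (U : Subset n) r → ∣ U ∣ ℕ.< r → splits U r ≡ []
  splits-empty []            (suc r) lt         = refl
  splits-empty (outside ∷ U) r       lt         = cong (map skips) (splits-empty U r lt)
  splits-empty (inside ∷ U)  (suc r) (ℕ.s≤s lt) =
    cong₂ (λ xs ys → map leaves xs ++ map takes ys) (splits-empty U (suc r) (ℕₚ.m<n⇒m<1+n lt)) (splits-empty U r lt)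

  -- The arcs on suc n vertices: those that start at the vertex zero, given by the
  -- set of their right endpoints among the other vertices, and the remaining ones.
  data Triangle : ℕ → Set where
    []  : Triangle 0
    _∷_ : ∀ {n} → Subset n → Triangle n → Triangle (suc n)

  entry : ∀ {n} → Triangle n → Fin n → Fin n → Bool
  entry (C ∷ c) i       zero    = false
  entry (C ∷ c) zero    (suc j) = lookup C j
  entry (C ∷ c) (suc i) (suc j) = entry c i j

  -- V is the set of elements of T that are not a right endpoint yet.
  data Partial : ∀ {n} → (Fin n → ℕ) → Subset n → Triangle n → Subset n → Set where
    []  : ∀ {S} → Partial S [] [] []
    _∷_ : ∀ {n S t} {T C U V : Subset n} {c} →
          Split U (S zero) C V → Partial (S ∘ suc) T c U → Partial S (t ∷ T) (C ∷ c) (t ∷ V)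

  partial-rows : ∀ {n S} {T V : Subset n} {c} → Partial S T c V → ∀ i → sumℕ (λ j → bit (entry c i j)) ≡ S i
  partial-rows (_∷_ {C = C} σ p) zero    = trans (sum-indicator C) (split-∣∣ σ)
  partial-rows (σ ∷ p)           (suc i) = partial-rows p i

  partial-columns : ∀ {n S} {T V : Subset n} {c} → Partial S T c V →
                    ∀ j → sumℕ (λ i → bit (entry c i j)) ℕ.+ indicator V j ≡ indicator T j
  partial-columns (_∷_ {n} {t = t} σ p) zero = cong (ℕ._+ bit t) (sum-zeros {n} (λ _ → refl))
  partial-columns (_∷_ {T = T} {C} {U} {V} {c} σ p) (suc j) = begin
    indicator C j ℕ.+ column ℕ.+ indicator V j      ≡⟨ cong (ℕ._+ indicator V j) (ℕₚ.+-comm (indicator C j) column) ⟩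
    column ℕ.+ indicator C j ℕ.+ indicator V j      ≡⟨ ℕₚ.+-assoc column _ _ ⟩
    column ℕ.+ (indicator C j ℕ.+ indicator V j)    ≡⟨ cong (column ℕ.+_) (split-indicator σ j) ⟩
    column ℕ.+ indicator U j                        ≡⟨ partial-columns p j ⟩
    indicator T j                                   ∎
    where column = sumℕ (λ i → bit (entry c i j))

  bit≤1 : ∀ b → bit b ℕ.≤ 1
  bit≤1 false = ℕ.z≤n
  bit≤1 true  = ℕ.s≤s ℕ.z≤n

  partial⁺ : ∀ {n} (S : Fin n → ℕ) (T V : Subset n) (c : Triangle n) →
             (∀ i → sumℕ (λ j → bit (entry c i j)) ≡ S i) →
             (∀ j → sumℕ (λ i → bit (entry c i j)) ℕ.+ indicator V j ≡ indicator T j) →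
             Partial S T c V
  partial⁺ S [] [] [] rows columns = []
  partial⁺ {suc n} S (t ∷ T) (v ∷ V) (C ∷ c) rows columns = subst (λ v → Partial S (t ∷ T) (C ∷ c) (v ∷ V)) (sym v≡t)
    (subst (λ r → Split (C ∪ V) r C V) (trans (sym (sum-indicator C)) (rows zero)) σ
     ∷ partial⁺ (S ∘ suc) T (C ∪ V) c (rows ∘ suc) columns′)
    where
    v≡t : v ≡ t
    v≡t = bit-injective (trans (cong (ℕ._+ bit v) (sym (sum-zeros {n} (λ _ → refl)))) (columns zero))
    column : Fin _ → ℕ
    column j = sumℕ (λ i → bit (entry c i j))
    shuffle : ∀ j → column j ℕ.+ (indicator C j ℕ.+ indicator V j) ≡ indicator T j
    shuffle j = begin
      column j ℕ.+ (indicator C j ℕ.+ indicator V j)    ≡⟨ ℕₚ.+-assoc (column j) _ _ ⟨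
      column j ℕ.+ indicator C j ℕ.+ indicator V j      ≡⟨ cong (ℕ._+ indicator V j) (ℕₚ.+-comm (column j) (indicator C j)) ⟩
      indicator C j ℕ.+ column j ℕ.+ indicator V j      ≡⟨ columns (suc j) ⟩
      indicator T j                                     ∎
    σ : Split (C ∪ V) ∣ C ∣ C V
    σ = disjoint⇒split C V λ j → ℕₚ.≤-trans (ℕₚ.m≤n+m _ (column j)) (ℕₚ.≤-trans (ℕₚ.≤-reflexive (shuffle j)) (bit≤1 (lookup T j)))
    columns′ : ∀ j → column j ℕ.+ indicator (C ∪ V) j ≡ indicator T j
    columns′ j = trans (cong (column j ℕ.+_) (sym (split-indicator σ j))) (shuffle j)

  partial-size : ∀ {n S} {T V : Subset n} {c} → Partial S T c V → sumℕ S ℕ.+ ∣ V ∣ ≡ ∣ T ∣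
  partial-size [] = refl
  partial-size {S = S} (_∷_ {t = t} {T} {C} {U} {V} σ p) = begin
    S zero ℕ.+ sumℕ (S ∘ suc) ℕ.+ ∣ t ∷ V ∣         ≡⟨ cong (S zero ℕ.+ sumℕ (S ∘ suc) ℕ.+_) (∣∷∣ t V) ⟩
    S zero ℕ.+ sumℕ (S ∘ suc) ℕ.+ (bit t ℕ.+ ∣ V ∣) ≡⟨ solve 4 (λ a b t v → a :+ b :+ (t :+ v) := t :+ (b :+ (a :+ v))) refl (S zero) _ (bit t) ∣ V ∣ ⟩
    bit t ℕ.+ (sumℕ (S ∘ suc) ℕ.+ (S zero ℕ.+ ∣ V ∣)) ≡⟨ cong (λ k → bit t ℕ.+ (sumℕ (S ∘ suc) ℕ.+ k)) (split-rest σ) ⟩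
    bit t ℕ.+ (sumℕ (S ∘ suc) ℕ.+ ∣ U ∣)            ≡⟨ cong (bit t ℕ.+_) (partial-size p) ⟩
    bit t ℕ.+ ∣ T ∣                                 ≡⟨ ∣∷∣ t T ⟨
    ∣ t ∷ T ∣                                       ∎
    where
    open +-*-Solver
    ∣∷∣ : ∀ {n} b (p : Subset n) → ∣ b ∷ p ∣ ≡ bit b ℕ.+ ∣ p ∣
    ∣∷∣ inside  p = refl
    ∣∷∣ outside p = refl

  extend : ∀ {n} → Bool → Triangle n → Subset n × Subset n → Triangle (suc n) × Subset (suc n)
  extend t c (C , V) = C ∷ c , t ∷ V

  extensions : ∀ {n} → Bool → ℕ → Triangle n × Subset n → List (Triangle (suc n) × Subset (suc n))
  extensions t r (c , U) = map (extend t c) (splits U r)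

  partials : ∀ {n} → (Fin n → ℕ) → Subset n → List (Triangle n × Subset n)
  partials S []      = [ [] , [] ]
  partials S (t ∷ T) = concatMap (extensions t (S zero)) (partials (S ∘ suc) T)

  ∈-partials⁻ : ∀ {n} (S : Fin n → ℕ) T {c V} → (c , V) ∈ˡ partials S T → Partial S T c V
  ∈-partials⁻ S []      (here refl) = []
  ∈-partials⁻ S (t ∷ T) p
    with (c , U) , cU∈ , q ← find (∈-concatMap⁻ (extensions t (S zero)) {xs = partials (S ∘ suc) T} p)
    with (C , V) , CV∈ , refl ← ∈-map⁻ (extend t c) q
    = ∈-splits⁻ U (S zero) CV∈ ∷ ∈-partials⁻ (S ∘ suc) T cU∈

  ∈-partials⁺ : ∀ {n S} {T V : Subset n} {c} → Partial S T c V → (c , V) ∈ˡ partials S T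
  ∈-partials⁺ [] = here refl
  ∈-partials⁺ {S = S} (_∷_ {t = t} {c = c} σ p) =
    ∈-concatMap⁺ (extensions t (S zero))
      (lose (∈-partials⁺ p) (∈-map⁺ (extend t c) (∈-splits⁺ σ)))

  partials-unique : ∀ {n} (S : Fin n → ℕ) T → Unique (partials S T)
  partials-unique S []      = All.[] ∷ []
  partials-unique S (t ∷ T) = Uniqueₚ.concat⁺
    (Allₚ.map⁺ (All.universal (λ (c , U) → Uniqueₚ.map⁺ (λ { refl → refl }) (splits-unique U (S zero))) (partials (S ∘ suc) T)))
    (AllPairsₚ.map⁺ (AllPairs.map disjoint (partials-unique (S ∘ suc) T)))
    where
    disjoint : ∀ {p p′ : Triangle _ × Subset _} → p ≢ p′ →
               Disjoint (extensions t (S zero) p) (extensions t (S zero) p′)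
    disjoint {c , U} {c′ , U′} p≢p′ (v∈ , v∈′)
      with (C , V) , CV∈ , refl ← ∈-map⁻ (extend t c) v∈
      with (C′ , V′) , CV∈′ , refl ← ∈-map⁻ (extend t c′) v∈′
      = p≢p′ (cong (c ,_) (trans (sym (split-whole (∈-splits⁻ U (S zero) CV∈))) (split-whole (∈-splits⁻ U′ (S zero) CV∈′))))

  asMultiset≗indicator : ∀ {n} (T : Subset n) v → asMultiset T v ≡ indicator T v
  asMultiset≗indicator (inside ∷ T)  zero    = refl
  asMultiset≗indicator (outside ∷ T) zero    = refl
  asMultiset≗indicator (t ∷ T)       (suc v) = asMultiset≗indicator T v

  partial-height : ∀ {n S t} {T V : Subset n} {c} → Partial (S ∘ suc) T c V → height S (t ∷ T) zero ≡ + ∣ V ∣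
  partial-height {n} {S} {t} {T} {V} p = begin
    + sumℕ (asMultiset T) ℤ.- + sumℕ (S ∘ suc)
      ≡⟨ cong (λ k → + k ℤ.- + sumℕ (S ∘ suc)) (trans (sum-cong-≗ (asMultiset≗indicator T)) (sum-indicator T)) ⟩
    + ∣ T ∣ ℤ.- + sumℕ (S ∘ suc)
      ≡⟨ ℤₚ.m-n≡m⊖n ∣ T ∣ (sumℕ (S ∘ suc)) ⟩
    ∣ T ∣ ℤ.⊖ sumℕ (S ∘ suc)
      ≡⟨ cong (ℤ._⊖ sumℕ (S ∘ suc)) (partial-size p) ⟨
    (sumℕ (S ∘ suc) ℕ.+ ∣ V ∣) ℤ.⊖ sumℕ (S ∘ suc)
      ≡⟨ ℤₚ.⊖-≥ (ℕₚ.m≤m+n (sumℕ (S ∘ suc)) ∣ V ∣) ⟩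
    + (sumℕ (S ∘ suc) ℕ.+ ∣ V ∣ ℕ.∸ sumℕ (S ∘ suc))
      ≡⟨ cong +_ (ℕₚ.m+n∸m≡n (sumℕ (S ∘ suc)) ∣ V ∣) ⟩
    + ∣ V ∣ ∎

  ascents : ∀ {n} → Subset n → Subset n → ℕ
  ascents []      []      = 0
  ascents (v ∷ V) (c ∷ C) = bit v ℕ.* ∣ C ∣ ℕ.+ ascents V C

  descents : ∀ {n} → Subset n → Subset n → ℕ
  descents V C = ascents C V

  PairStatistic : Set
  PairStatistic = ∀ {n} → Subset n → Subset n → ℕ

  Additive : PairStatistic → Set
  Additive κ = ∀ {n r} {U C V : Subset n} → Split U r C V → ∀ D → κ U D ≡ κ C D ℕ.+ κ V D

  ascents-additive : Additive ascents
  ascents-additive []        []      = refl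
  ascents-additive (skip σ)  (d ∷ D) = ascents-additive σ D
  ascents-additive {U = _ ∷ U} {_ ∷ C} {_ ∷ V} (leave σ) (d ∷ D) =
    trans (cong (∣ D ∣ ℕ.+ 0 ℕ.+_) (ascents-additive σ D))
          (solve 3 (λ d a b → d :+ con 0 :+ (a :+ b) := a :+ (d :+ con 0 :+ b)) refl ∣ D ∣ (ascents C D) (ascents V D))
    where open +-*-Solver
  ascents-additive {U = _ ∷ U} {_ ∷ C} {_ ∷ V} (take σ) (d ∷ D) =
    trans (cong (∣ D ∣ ℕ.+ 0 ℕ.+_) (ascents-additive σ D))
          (solve 3 (λ d a b → d :+ con 0 :+ (a :+ b) := d :+ con 0 :+ a :+ b) refl ∣ D ∣ (ascents C D) (ascents V D))
    where open +-*-Solver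

  descents-additive : Additive descents
  descents-additive []        []      = refl
  descents-additive {U = _ ∷ U} {_ ∷ C} {_ ∷ V} σ (d ∷ D) = begin
    bit d ℕ.* ∣ U ∣ ℕ.+ ascents D U
      ≡⟨ cong₂ (λ k l → bit d ℕ.* k ℕ.+ l) (split-sizes (split-tail σ)) (descents-additive (split-tail σ) D) ⟩
    bit d ℕ.* (∣ C ∣ ℕ.+ ∣ V ∣) ℕ.+ (ascents D C ℕ.+ ascents D V)
      ≡⟨ solve 5 (λ d c v a b → d :* (c :+ v) :+ (a :+ b) := d :* c :+ a :+ (d :* v :+ b)) refl (bit d) ∣ C ∣ ∣ V ∣ (ascents D C) (ascents D V) ⟩
    bit d ℕ.* ∣ C ∣ ℕ.+ ascents D C ℕ.+ (bit d ℕ.* ∣ V ∣ ℕ.+ ascents D V) ∎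
    where open +-*-Solver

  module Statistic (κ : PairStatistic) where

    -- Pairs of a future arc ending in `V` and an arc of the triangle that starts to the left of
    -- that end. The bit `v` is dropped because no arc of the triangle starts to the left of the
    -- vertex zero.
    pendingPairs : ∀ {n} → Triangle n → Subset n → ℕ
    pendingPairs []      []      = 0
    pendingPairs (C ∷ c) (v ∷ V) = κ V C ℕ.+ pendingPairs c V

    arcPairs : ∀ {n} → Triangle n → ℕ
    arcPairs []      = 0
    arcPairs (C ∷ c) = pendingPairs c C ℕ.+ arcPairs c

    -- The elements of V count as right endpoints of arcs whose left endpoint is
    -- smaller than all the vertices.
    pairs : ∀ {n} → Triangle n → Subset n → ℕ
    pairs c V = arcPairs c ℕ.+ pendingPairs c V

    pendingPairs-⊥ : (∀ {n} (C : Subset n) → κ ⊥ C ≡ 0) → ∀ {n} (c : Triangle n) → pendingPairs c ⊥ ≡ 0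
    pendingPairs-⊥ κ-⊥ []      = refl
    pendingPairs-⊥ κ-⊥ (C ∷ c) = cong₂ ℕ._+_ (κ-⊥ C) (pendingPairs-⊥ κ-⊥ c)

    pairs-⊥ : (∀ {n} (C : Subset n) → κ ⊥ C ≡ 0) → ∀ {n} (c : Triangle n) → pairs c ⊥ ≡ arcPairs c
    pairs-⊥ κ-⊥ c = trans (cong (arcPairs c ℕ.+_) (pendingPairs-⊥ κ-⊥ c)) (ℕₚ.+-identityʳ (arcPairs c))

    module _ (additive : Additive κ) where

      pendingPairs-additive : ∀ {n r} {U C V : Subset n} → Split U r C V → ∀ c →
                              pendingPairs c U ≡ pendingPairs c C ℕ.+ pendingPairs c V
      pendingPairs-additive {U = []}    {[]}    {[]}    σ []      = refl
      pendingPairs-additive {U = _ ∷ U} {_ ∷ C} {_ ∷ V} σ (D ∷ c) =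
        trans (cong₂ ℕ._+_ (additive (split-tail σ) D) (pendingPairs-additive (split-tail σ) c))
              (solve 4 (λ a b c d → a :+ b :+ (c :+ d) := a :+ c :+ (b :+ d)) refl (κ C D) _ _ _)
        where open +-*-Solver

      pairs-extend : ∀ {n r} {t} {U C V : Subset n} → Split U r C V → ∀ c →
                     pairs (C ∷ c) (t ∷ V) ≡ pairs c U ℕ.+ κ V C
      pairs-extend {U = U} {C} {V} σ c = begin
        pendingPairs c C ℕ.+ arcPairs c ℕ.+ (κ V C ℕ.+ pendingPairs c V)
          ≡⟨ solve 4 (λ a b k d → a :+ b :+ (k :+ d) := b :+ (a :+ d) :+ k) refl (pendingPairs c C) (arcPairs c) (κ V C) _ ⟩
        arcPairs c ℕ.+ (pendingPairs c C ℕ.+ pendingPairs c V) ℕ.+ κ V C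
          ≡⟨ cong (λ k → arcPairs c ℕ.+ k ℕ.+ κ V C) (pendingPairs-additive σ c) ⟨
        pairs c U ℕ.+ κ V C ∎
        where open +-*-Solver

open PartialDiagrams

-- Generating functions of splits and of partial diagrams

module WeightedSums {c ℓ} (R : Indeterminates c ℓ) where
  open Indeterminates R hiding (zero)
  open GaussianBinomials R
  open Exp commutativeSemiring using (^-homo-*)
  open CommutativeSemiringSolver commutativeSemiring using (solve; _:+_; _:*_; _:=_)
  open SetoidReasoning setoid

  sumOver-cong : ∀ {a} {A : Set a} (L : List A) {f g : A → Carrier} →
                 (∀ {z} → z ∈ˡ L → f z ≈ g z) → sumOver L f ≈ sumOver L g
  sumOver-cong []      f≈g = refl
  sumOver-cong (z ∷ L) f≈g = +-cong (f≈g (here ≡.refl)) (sumOver-cong L (f≈g ∘ there))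

  sumOver-++ : ∀ {a} {A : Set a} (L M : List A) (f : A → Carrier) → sumOver (L ++ M) f ≈ sumOver L f + sumOver M f
  sumOver-++ []      M f = sym (+-identityˡ _)
  sumOver-++ (z ∷ L) M f = trans (+-congˡ (sumOver-++ L M f)) (sym (+-assoc _ _ _))

  sumOver-scale : ∀ {a} {A : Set a} (L : List A) u (f : A → Carrier) → sumOver L (λ z → u * f z) ≈ u * sumOver L f
  sumOver-scale []      u f = sym (zeroʳ u)
  sumOver-scale (z ∷ L) u f = trans (+-congˡ (sumOver-scale L u f)) (sym (distribˡ u _ _))

  sumOver-map : ∀ {a b} {A : Set a} {B : Set b} (g : A → B) (L : List A) (f : B → Carrier) →
                sumOver (map g L) f ≈ sumOver L (f ∘ g)
  sumOver-map g []      f = refl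
  sumOver-map g (z ∷ L) f = +-congˡ (sumOver-map g L f)

  sumOver-concatMap : ∀ {a b} {A : Set a} {B : Set b} (g : A → List B) (L : List A) (f : B → Carrier) →
                      sumOver (concatMap g L) f ≈ sumOver L (λ z → sumOver (g z) f)
  sumOver-concatMap g []      f = refl
  sumOver-concatMap g (z ∷ L) f = trans (sumOver-++ (g z) (concatMap g L) f) (+-congˡ (sumOver-concatMap g L f))

  sumOver-↭ : ∀ {a} {A : Set a} {L M : List A} → L ↭ M → (f : A → Carrier) → sumOver L f ≈ sumOver M f
  sumOver-↭ ↭.refl          f = refl
  sumOver-↭ (↭.prep z σ)    f = +-congˡ (sumOver-↭ σ f)
  sumOver-↭ (↭.swap z w σ)  f = trans (+-congˡ (+-congˡ (sumOver-↭ σ f)))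
    (solve 3 (λ a b c → a :+ (b :+ c) := b :+ (a :+ c)) refl (f z) (f w) _)
  sumOver-↭ (↭.trans σ τ)   f = trans (sumOver-↭ σ f) (sumOver-↭ τ f)

  module Weights (u v : Carrier) (weights : ∀ r s → PascalWeights u v r s) where

    weight : ℕ → ℕ → Carrier
    weight i j = u ^ i * v ^ j

    weight-+ : ∀ i j k l → weight (i ℕ.+ k) (j ℕ.+ l) ≈ weight i j * weight k l
    weight-+ i j k l = trans (*-cong (^-homo-* u i k) (^-homo-* v j l))
      (solve 4 (λ a b c d → a :* b :* (c :* d) := a :* c :* (b :* d)) refl (u ^ i) (u ^ k) (v ^ j) (v ^ l))

    splitWeight : ∀ {n} → Subset n × Subset n → Carrier
    splitWeight (C , V) = weight (ascents V C) (descents V C)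

    sum-leaves : ∀ {n} (U : Subset n) r → sumOver (map leaves (splits U r)) splitWeight ≈ u ^ r * sumOver (splits U r) splitWeight
    sum-leaves U r = begin
      sumOver (map leaves (splits U r)) splitWeight       ≈⟨ sumOver-map leaves (splits U r) splitWeight ⟩
      sumOver (splits U r) (splitWeight ∘ leaves)         ≈⟨ sumOver-cong (splits U r) step ⟩
      sumOver (splits U r) (λ p → u ^ r * splitWeight p)  ≈⟨ sumOver-scale (splits U r) (u ^ r) splitWeight ⟩
      u ^ r * sumOver (splits U r) splitWeight            ∎
      where
      step : ∀ {p} → p ∈ˡ splits U r → splitWeight (leaves p) ≈ u ^ r * splitWeight p
      step {C , V} p∈ = begin
        weight (∣ C ∣ ℕ.+ 0 ℕ.+ ascents V C) (ascents C V)
          ≡⟨ ≡.cong (λ k → weight (k ℕ.+ ascents V C) (ascents C V)) (≡.trans (ℕₚ.+-identityʳ ∣ C ∣) (split-∣∣ (∈-splits⁻ U r p∈))) ⟩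
        weight (r ℕ.+ ascents V C) (ascents C V)   ≈⟨ weight-+ r 0 (ascents V C) (ascents C V) ⟩
        u ^ r * 1# * splitWeight (C , V)           ≈⟨ *-congʳ (*-identityʳ (u ^ r)) ⟩
        u ^ r * splitWeight (C , V)                ∎

    sum-takes : ∀ {n} (U : Subset n) r s → ∣ U ∣ ≡ r ℕ.+ s →
                sumOver (map takes (splits U r)) splitWeight ≈ v ^ s * sumOver (splits U r) splitWeight
    sum-takes U r s ∣U∣≡r+s = begin
      sumOver (map takes (splits U r)) splitWeight        ≈⟨ sumOver-map takes (splits U r) splitWeight ⟩
      sumOver (splits U r) (splitWeight ∘ takes)          ≈⟨ sumOver-cong (splits U r) step ⟩
      sumOver (splits U r) (λ p → v ^ s * splitWeight p)  ≈⟨ sumOver-scale (splits U r) (v ^ s) splitWeight ⟩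
      v ^ s * sumOver (splits U r) splitWeight            ∎
      where
      step : ∀ {p} → p ∈ˡ splits U r → splitWeight (takes p) ≈ v ^ s * splitWeight p
      step {C , V} p∈ = begin
        weight (ascents V C) (∣ V ∣ ℕ.+ 0 ℕ.+ ascents C V)
          ≡⟨ ≡.cong (λ k → weight (ascents V C) (k ℕ.+ ascents C V))
               (≡.trans (ℕₚ.+-identityʳ ∣ V ∣) (ℕₚ.+-cancelˡ-≡ r _ _ (≡.trans (split-rest (∈-splits⁻ U r p∈)) ∣U∣≡r+s))) ⟩
        weight (ascents V C) (s ℕ.+ ascents C V)   ≈⟨ weight-+ 0 s (ascents V C) (ascents C V) ⟩
        1# * v ^ s * splitWeight (C , V)           ≈⟨ *-congʳ (*-identityˡ (v ^ s)) ⟩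
        v ^ s * splitWeight (C , V)                ∎

    gauss-zero : ∀ r → gauss u v r 0 ≈ 1#
    gauss-zero zero    = refl
    gauss-zero (suc r) = refl

    -- The recursion of `gauss` is the decision about the smallest element of `U`. Positions outside
    -- `U` change neither statistic, so only the size of `U` matters.
    sum-splits : ∀ {n} (U : Subset n) r s → ∣ U ∣ ≡ r ℕ.+ s → sumOver (splits U r) splitWeight ≈ gauss u v r s
    sum-splits []            zero    s       eq = trans (+-identityʳ _) (*-identityˡ 1#)
    sum-splits (outside ∷ U) r       s       eq = trans (sumOver-map skips (splits U r) splitWeight) (sum-splits U r s eq)
    sum-splits (inside ∷ U)  zero    (suc s) eq = begin
      sumOver (map leaves (splits U 0)) splitWeight   ≈⟨ sum-leaves U 0 ⟩
      1# * sumOver (splits U 0) splitWeight           ≈⟨ *-identityˡ _ ⟩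
      sumOver (splits U 0) splitWeight                ≈⟨ sum-splits U 0 s (ℕₚ.suc-injective eq) ⟩
      1#                                              ∎
    sum-splits (inside ∷ U)  (suc r) zero    eq = begin
      sumOver (map leaves (splits U (suc r)) ++ map takes (splits U r)) splitWeight
        -- With `s` zero every element has to be chosen, so no split leaves the smallest one out.
        ≡⟨ ≡.cong (λ L → sumOver (map leaves L ++ map takes (splits U r)) splitWeight) (splits-empty U (suc r) ∣U∣<1+r) ⟩
      sumOver (map takes (splits U r)) splitWeight   ≈⟨ sum-takes U r 0 (ℕₚ.suc-injective eq) ⟩
      1# * sumOver (splits U r) splitWeight          ≈⟨ *-identityˡ _ ⟩
      sumOver (splits U r) splitWeight               ≈⟨ sum-splits U r 0 (ℕₚ.suc-injective eq) ⟩
      gauss u v r 0                                  ≈⟨ gauss-zero r ⟩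
      1#                                             ∎
      where
      ∣U∣<1+r : ∣ U ∣ ℕ.< suc r
      ∣U∣<1+r = ℕₚ.≤-reflexive (≡.trans eq (≡.cong suc (ℕₚ.+-identityʳ r)))
    sum-splits (inside ∷ U)  (suc r) (suc s) eq = begin
      sumOver (map leaves (splits U (suc r)) ++ map takes (splits U r)) splitWeight
        ≈⟨ sumOver-++ (map leaves (splits U (suc r))) _ splitWeight ⟩
      sumOver (map leaves (splits U (suc r))) splitWeight + sumOver (map takes (splits U r)) splitWeight
        ≈⟨ +-cong (sum-leaves U (suc r)) (sum-takes U r (suc s) ∣U∣≡) ⟩
      u ^ suc r * sumOver (splits U (suc r)) splitWeight + v ^ suc s * sumOver (splits U r) splitWeight
        ≈⟨ +-cong (*-congˡ (sum-splits U (suc r) s (≡.trans ∣U∣≡ (ℕₚ.+-suc r s)))) (*-congˡ (sum-splits U r (suc s) ∣U∣≡)) ⟩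
      gauss u v (suc r) (suc s) ∎
      where
      ∣U∣≡ : ∣ U ∣ ≡ r ℕ.+ suc s
      ∣U∣≡ = ℕₚ.suc-injective eq

    sum-splits≈factor : ∀ {n} (U : Subset n) r → sumOver (splits U r) splitWeight ≈ factor (+ ∣ U ∣) r
    sum-splits≈factor U r with r ℕ.≤? ∣ U ∣
    ... | yes r≤∣U∣ = begin
      sumOver (splits U r) splitWeight        ≈⟨ sum-splits U r (∣ U ∣ ℕ.∸ r) (≡.sym (ℕₚ.m+[n∸m]≡n r≤∣U∣)) ⟩
      gauss u v r (∣ U ∣ ℕ.∸ r)               ≈⟨ gauss≈factor weights r _ ⟩
      factor (+ (r ℕ.+ (∣ U ∣ ℕ.∸ r))) r      ≡⟨ ≡.cong (λ k → factor (+ k) r) (ℕₚ.m+[n∸m]≡n r≤∣U∣) ⟩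
      factor (+ ∣ U ∣) r                      ∎
    ... | no r≰∣U∣ = begin
      sumOver (splits U r) splitWeight        ≡⟨ ≡.cong (λ L → sumOver L splitWeight) (splits-empty U r (ℕₚ.≰⇒> r≰∣U∣)) ⟩
      0#                                      ≈⟨ factor-zero (ℕₚ.≰⇒> r≰∣U∣) ⟨
      factor (+ ∣ U ∣) r                      ∎

    partialWeight : ∀ {n} → Triangle n × Subset n → Carrier
    partialWeight (c , V) = weight (Statistic.pairs ascents c V) (Statistic.pairs descents c V)

    sum-extensions : ∀ {n} t r (p : Triangle n × Subset n) →
                     sumOver (extensions t r p) partialWeight ≈ partialWeight p * factor (+ ∣ proj₂ p ∣) r
    sum-extensions t r (c , U) = begin
      sumOver (extensions t r (c , U)) partialWeight                           ≈⟨ sumOver-map (extend t c) (splits U r) partialWeight ⟩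
      sumOver (splits U r) (partialWeight ∘ extend t c)                        ≈⟨ sumOver-cong (splits U r) step ⟩
      sumOver (splits U r) (λ s → partialWeight (c , U) * splitWeight s)       ≈⟨ sumOver-scale (splits U r) (partialWeight (c , U)) splitWeight ⟩
      partialWeight (c , U) * sumOver (splits U r) splitWeight                 ≈⟨ *-congˡ (sum-splits≈factor U r) ⟩
      partialWeight (c , U) * factor (+ ∣ U ∣) r                               ∎
      where
      step : ∀ {s} → s ∈ˡ splits U r → partialWeight (extend t c s) ≈ partialWeight (c , U) * splitWeight s
      step {C , V} s∈ = trans
        (reflexive (≡.cong₂ weight (Statistic.pairs-extend ascents ascents-additive {t = t} σ c)
                                   (Statistic.pairs-extend descents descents-additive {t = t} σ c)))
        (weight-+ (Statistic.pairs ascents c U) (Statistic.pairs descents c U) (ascents V C) (descents V C))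
        where σ = ∈-splits⁻ U r s∈

    sum-partials : ∀ {n} (S : Fin n → ℕ) T → sumOver (partials S T) partialWeight ≈ product (λ i → factor (height S T i) (S i))
    sum-partials S []      = trans (+-identityʳ _) (*-identityˡ 1#)
    sum-partials S (t ∷ T) = begin
      sumOver (partials S (t ∷ T)) partialWeight
        ≈⟨ sumOver-concatMap (extensions t (S zero)) (partials (S ∘ suc) T) partialWeight ⟩
      sumOver (partials (S ∘ suc) T) (λ p → sumOver (extensions t (S zero) p) partialWeight)
        -- The height is identified with a size separately for each diagram `p` in the list. If the
        -- list is empty there is nothing to show, whatever the sign of the height; otherwise the
        -- factor is the same for all `p` and leaves the sum.
        ≈⟨ sumOver-cong (partials (S ∘ suc) T) (λ {p} p∈ → trans (sum-extensions t (S zero) p) (trans (*-comm _ _)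
             (*-congʳ (reflexive (≡.cong (λ h → factor h (S zero)) (≡.sym (partial-height {S = S} {t = t} (∈-partials⁻ (S ∘ suc) T p∈)))))))) ⟩
      sumOver (partials (S ∘ suc) T) (λ p → factor (height S (t ∷ T) zero) (S zero) * partialWeight p)
        ≈⟨ sumOver-scale (partials (S ∘ suc) T) _ partialWeight ⟩
      factor (height S (t ∷ T) zero) (S zero) * sumOver (partials (S ∘ suc) T) partialWeight
        ≈⟨ *-congˡ (sum-partials (S ∘ suc) T) ⟩
      product (λ i → factor (height S (t ∷ T) i) (S i)) ∎

-- Crossings and nestings as statistics of the arc matrix

module ArcCounts where
  open import Data.Nat.ListAction using (sum)
  open ≡ using (refl; sym; trans; cong; cong₂; subst; module ≡-Reasoning)
  open ≡-Reasoning
  open CommutativeMonoidSum ℕₚ.+-0-commutativeMonoid using (sum-cong-≗; ∑-distrib-+; ∑-comm)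
  open SemiringSum ℕₚ.+-*-semiring using (*-distribˡ-sum)

  length-filter : ∀ {a p} {A : Set a} {P : Pred A p} (P? : Decidable P) (L : List A) →
                  length (filter P? L) ≡ sum (map (λ z → bit (does (P? z))) L)
  length-filter P? []      = refl
  length-filter P? (z ∷ L) with does (P? z)
  ... | true  = cong suc (length-filter P? L)
  ... | false = length-filter P? L

  sum-filter : ∀ {a p} {A : Set a} {P : Pred A p} (P? : Decidable P) (f : A → ℕ) (L : List A) →
               sum (map f (filter P? L)) ≡ sum (map (λ z → bit (does (P? z)) ℕ.* f z) L)
  sum-filter P? f []      = refl
  sum-filter P? f (z ∷ L) with does (P? z)
  ... | true  = cong₂ ℕ._+_ (sym (ℕₚ.*-identityˡ (f z))) (sum-filter P? f L)
  ... | false = sum-filter P? f L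

  sum-cartesianProduct : ∀ {a b} {A : Set a} {B : Set b} (f : A × B → ℕ) (L : List A) (M : List B) →
                         sum (map f (cartesianProduct L M)) ≡ sum (map (λ z → sum (map (λ w → f (z , w)) M)) L)
  sum-cartesianProduct f []      M = refl
  sum-cartesianProduct f (z ∷ L) M = begin
    sum (map f (map (z ,_) M ++ cartesianProduct L M))                ≡⟨ cong sum (map-++ f (map (z ,_) M) _) ⟩
    sum (map f (map (z ,_) M) ++ map f (cartesianProduct L M))        ≡⟨ sum-++ (map f (map (z ,_) M)) _ ⟩
    sum (map f (map (z ,_) M)) ℕ.+ sum (map f (cartesianProduct L M)) ≡⟨ cong₂ ℕ._+_ (cong sum (sym (map-∘ M))) (sum-cartesianProduct f L M) ⟩
    sum (map (λ w → f (z , w)) M) ℕ.+ sum (map (λ z → sum (map (λ w → f (z , w)) M)) L) ∎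

  sum-allFin : ∀ {n} (f : Fin n → ℕ) → sum (map f (allFin n)) ≡ sumℕ f
  sum-allFin f = trans (cong sum (map-tabulate id f)) (sum-tabulate f)
    where
    sum-tabulate : ∀ {n} (f : Fin n → ℕ) → sum (List.tabulate f) ≡ sumℕ f
    sum-tabulate {zero}  f = refl
    sum-tabulate {suc n} f = cong (f zero ℕ.+_) (sum-tabulate (f ∘ suc))

  sum-delta : ∀ {n} (f : Fin n → ℕ) i → sumℕ (λ k → f k ℕ.* bit (does (k ≟ i))) ≡ f i
  sum-delta {suc n} f zero    = trans (cong₂ ℕ._+_ (ℕₚ.*-identityʳ (f zero)) (sum-zeros (λ k → ℕₚ.*-zeroʳ (f (suc k))))) (ℕₚ.+-identityʳ (f zero))
  sum-delta {suc n} f (suc i) = cong₂ ℕ._+_ (ℕₚ.*-zeroʳ (f zero)) (sum-delta (f ∘ suc) i)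

  isArcᵇ : ∀ {n} → List (Subset n) → Fin n → Fin n → Bool
  isArcᵇ π i j = does (isArc? π (i , j))

  sum-arcs : ∀ {n} (π : List (Subset n)) (f : Arc n → ℕ) →
             sum (map f (arcs π)) ≡ sumℕ (λ i → sumℕ (λ j → bit (isArcᵇ π i j) ℕ.* f (i , j)))
  sum-arcs {n} π f = begin
    sum (map f (arcs π))
      ≡⟨ sum-filter (isArc? π) f (cartesianProduct (allFin n) (allFin n)) ⟩
    sum (map (λ α → bit (does (isArc? π α)) ℕ.* f α) (cartesianProduct (allFin n) (allFin n)))
      ≡⟨ sum-cartesianProduct _ (allFin n) (allFin n) ⟩
    sum (map (λ i → sum (map (λ j → bit (isArcᵇ π i j) ℕ.* f (i , j)) (allFin n))) (allFin n))
      ≡⟨ sum-allFin (λ i → sum (map (λ j → bit (isArcᵇ π i j) ℕ.* f (i , j)) (allFin n))) ⟩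
    sumℕ (λ i → sum (map (λ j → bit (isArcᵇ π i j) ℕ.* f (i , j)) (allFin n)))
      ≡⟨ sum-cong-≗ (λ i → sum-allFin (λ j → bit (isArcᵇ π i j) ℕ.* f (i , j))) ⟩
    sumℕ (λ i → sumℕ (λ j → bit (isArcᵇ π i j) ℕ.* f (i , j))) ∎

  left-row : ∀ {n} (π : List (Subset n)) i → left π i ≡ sumℕ (λ j → bit (isArcᵇ π i j))
  left-row {n} π i = begin
    left π i
      ≡⟨ length-filter (λ α → proj₁ α ≟ i) (arcs π) ⟩
    sum (map (λ α → bit (does (proj₁ α ≟ i))) (arcs π))
      ≡⟨ sum-arcs π _ ⟩
    sumℕ (λ k → sumℕ (λ j → bit (isArcᵇ π k j) ℕ.* bit (does (k ≟ i))))
      ≡⟨ ∑-comm {n} {n} _ ⟩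
    sumℕ (λ j → sumℕ (λ k → bit (isArcᵇ π k j) ℕ.* bit (does (k ≟ i))))
      ≡⟨ sum-cong-≗ (λ j → sum-delta (λ k → bit (isArcᵇ π k j)) i) ⟩
    sumℕ (λ j → bit (isArcᵇ π i j)) ∎

  right-column : ∀ {n} (π : List (Subset n)) j → right π j ≡ sumℕ (λ i → bit (isArcᵇ π i j))
  right-column π j = begin
    right π j
      ≡⟨ length-filter (λ α → proj₂ α ≟ j) (arcs π) ⟩
    sum (map (λ α → bit (does (proj₂ α ≟ j))) (arcs π))
      ≡⟨ sum-arcs π _ ⟩
    sumℕ (λ i → sumℕ (λ k → bit (isArcᵇ π i k) ℕ.* bit (does (k ≟ j))))
      ≡⟨ sum-cong-≗ (λ i → sum-delta (λ k → bit (isArcᵇ π i k)) j) ⟩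
    sumℕ (λ i → bit (isArcᵇ π i j)) ∎

  entry⇒< : ∀ {n} (c : Triangle n) i j → entry c i j ≡ true → i Fin.< j
  entry⇒< (C ∷ c) zero    (suc j) e = ℕ.s≤s ℕ.z≤n
  entry⇒< (C ∷ c) (suc i) (suc j) e = ℕ.s≤s (entry⇒< c i j e)

  arcSum : ∀ {n} → Triangle n → (Fin n → Fin n → ℕ) → ℕ
  arcSum c f = sumℕ (λ i → sumℕ (λ j → bit (entry c i j) ℕ.* f i j))

  arcSum-cong : ∀ {n} (c : Triangle n) {f g : Fin n → Fin n → ℕ} →
                (∀ i j → entry c i j ≡ true → f i j ≡ g i j) → arcSum c f ≡ arcSum c g
  arcSum-cong c {f} {g} f≡g = sum-cong-≗ λ i → sum-cong-≗ λ j → pointwise i j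
    where
    pointwise : ∀ i j → bit (entry c i j) ℕ.* f i j ≡ bit (entry c i j) ℕ.* g i j
    pointwise i j with entry c i j in eq
    ... | true  = cong (ℕ._+ 0) (f≡g i j eq)
    ... | false = refl

  arcSum-zero : ∀ {n} (c : Triangle n) {f : Fin n → Fin n → ℕ} → (∀ i j → f i j ≡ 0) → arcSum c f ≡ 0
  arcSum-zero c f≡0 = sum-zeros λ i → sum-zeros λ j → trans (cong (bit (entry c i j) ℕ.*_) (f≡0 i j)) (ℕₚ.*-zeroʳ (bit (entry c i j)))

  arcPairSum : ∀ {n} → (Arc n × Arc n → Bool) → Triangle n → ℕ
  arcPairSum P c = arcSum c λ i₁ j₁ → arcSum c λ i₂ j₂ → bit (P ((i₁ , j₁) , (i₂ , j₂)))

  length-arcPairs : ∀ {n} (π : List (Subset n)) (c : Triangle n) → (∀ i j → isArcᵇ π i j ≡ entry c i j) →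
                    ∀ {p} {P : Pred (Arc n × Arc n) p} (P? : Decidable P) →
                    length (filter P? (cartesianProduct (arcs π) (arcs π))) ≡ arcPairSum (λ p → does (P? p)) c
  length-arcPairs π c π≡c P? = begin
    length (filter P? (cartesianProduct (arcs π) (arcs π)))
      ≡⟨ length-filter P? (cartesianProduct (arcs π) (arcs π)) ⟩
    sum (map (λ p → bit (does (P? p))) (cartesianProduct (arcs π) (arcs π)))
      ≡⟨ sum-cartesianProduct _ (arcs π) (arcs π) ⟩
    sum (map (λ α → sum (map (λ β → bit (does (P? (α , β)))) (arcs π))) (arcs π))
      ≡⟨ cong sum (map-cong (λ α → sum-entries λ β → bit (does (P? (α , β)))) (arcs π)) ⟩
    sum (map (λ α → arcSum c λ i₂ j₂ → bit (does (P? (α , (i₂ , j₂))))) (arcs π))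
      ≡⟨ sum-entries (λ α → arcSum c λ i₂ j₂ → bit (does (P? (α , (i₂ , j₂))))) ⟩
    arcPairSum (λ p → does (P? p)) c ∎
    where
    sum-entries : ∀ f → sum (map f (arcs π)) ≡ arcSum c λ i j → f (i , j)
    sum-entries f = trans (sum-arcs π f)
      (sum-cong-≗ λ i → sum-cong-≗ λ j → cong (λ b → bit b ℕ.* f (i , j)) (π≡c i j))

  -- Crossings and nestings differ only in the comparison `B` of the right endpoints, so the passage
  -- from the arc matrix to the recursive statistics is done once for both. The field `order-suc`
  -- lets the vertex zero be stripped off.
  record Ordering (B : ∀ {n} → Fin n → Fin n → Bool) (κ : PairStatistic) : Set where
    field
      order-suc : ∀ {n} (i j : Fin n) → B (suc i) (suc j) ≡ B i j
      counts    : ∀ {n} (V C : Subset n) →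
                  sumℕ (λ j₁ → indicator V j₁ ℕ.* sumℕ (λ j₂ → indicator C j₂ ℕ.* bit (B j₁ j₂))) ≡ κ V C

  module _ {B : ∀ {n} → Fin n → Fin n → Bool} {κ : PairStatistic} (ordering : Ordering B κ) where
    open Ordering ordering
    open Statistic κ

    straddle : ∀ {n} → Fin n → Fin n → Fin n → Bool
    straddle i₂ j₁ j₂ = does (i₂ <? j₁) ∧ B j₁ j₂

    pendingPairs-sum : ∀ {n} (c : Triangle n) (V : Subset n) →
      sumℕ (λ j₁ → indicator V j₁ ℕ.* arcSum c (λ i₂ j₂ → bit (straddle i₂ j₁ j₂))) ≡ pendingPairs c V
    pendingPairs-sum []      []      = refl
    pendingPairs-sum (C ∷ c) (v ∷ V) = begin
      bit v ℕ.* arcSum (C ∷ c) (λ i₂ j₂ → 0) ℕ.+ sumℕ (λ j₁ → indicator V j₁ ℕ.* (starting (suc j₁) ℕ.+ later (suc j₁)))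
        -- A future arc that ends at the vertex zero straddles no left endpoint, so the term of `v`
        -- vanishes. The others separate into pairs with arcs from zero and pairs with later arcs.
        ≡⟨ cong₂ ℕ._+_ (trans (cong (bit v ℕ.*_) (arcSum-zero (C ∷ c) (λ _ _ → refl))) (ℕₚ.*-zeroʳ (bit v)))
             (sum-cong-≗ λ j₁ → trans (cong (indicator V j₁ ℕ.*_) (cong₂ ℕ._+_ (starting-suc j₁) (later-suc j₁))) (ℕₚ.*-distribˡ-+ (indicator V j₁) _ _)) ⟩
      sumℕ (λ j₁ → indicator V j₁ ℕ.* starting′ j₁ ℕ.+ indicator V j₁ ℕ.* later′ j₁)
        ≡⟨ ∑-distrib-+ (λ j₁ → indicator V j₁ ℕ.* starting′ j₁) _ ⟩
      sumℕ (λ j₁ → indicator V j₁ ℕ.* starting′ j₁) ℕ.+ sumℕ (λ j₁ → indicator V j₁ ℕ.* later′ j₁)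
        ≡⟨ cong₂ ℕ._+_ (counts V C) (pendingPairs-sum c V) ⟩
      κ V C ℕ.+ pendingPairs c V ∎
      where
      starting later : Fin _ → ℕ
      starting j₁ = sumℕ (λ j₂ → indicator C j₂ ℕ.* bit (B j₁ (suc j₂)))
      later    j₁ = arcSum c (λ i₂ j₂ → bit (straddle (suc i₂) j₁ (suc j₂)))
      starting′ later′ : Fin _ → ℕ
      starting′ j₁ = sumℕ (λ j₂ → indicator C j₂ ℕ.* bit (B j₁ j₂))
      later′    j₁ = arcSum c (λ i₂ j₂ → bit (straddle i₂ j₁ j₂))
      starting-suc : ∀ j₁ → starting (suc j₁) ≡ starting′ j₁
      starting-suc j₁ = sum-cong-≗ λ j₂ → cong (λ b → indicator C j₂ ℕ.* bit b) (order-suc j₁ j₂)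
      later-suc : ∀ j₁ → later (suc j₁) ≡ later′ j₁
      later-suc j₁ = arcSum-cong c λ i₂ j₂ _ → cong (λ b → bit (does (i₂ <? j₁) ∧ b)) (order-suc j₁ j₂)

    arcPairs-sum : ∀ {n} (c : Triangle n) →
      arcPairSum (λ ((i₁ , j₁) , (i₂ , j₂)) → does (i₁ <? i₂) ∧ straddle i₂ j₁ j₂) c ≡ arcPairs c
    arcPairs-sum []      = refl
    arcPairs-sum (C ∷ c) = cong₂ ℕ._+_
      (trans (sum-cong-≗ λ j₁ → cong (indicator C j₁ ℕ.*_) (cong₂ ℕ._+_ (no-start (λ j₂ → refl))
               (arcSum-cong c λ i₂ j₂ _ → cong (λ b → bit (does (i₂ <? j₁) ∧ b)) (order-suc j₁ j₂))))
             (pendingPairs-sum c C))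
      (trans (arcSum-cong c λ i₁ j₁ _ → cong₂ ℕ._+_ (no-start (λ j₂ → refl))
               (arcSum-cong c λ i₂ j₂ _ → cong (λ b → bit (does (i₁ <? i₂) ∧ (does (i₂ <? j₁) ∧ b))) (order-suc j₁ j₂)))
             (arcPairs-sum c))
      where
      no-start : ∀ {f : Fin _ → ℕ} → (∀ j → f j ≡ 0) → sumℕ (λ j → indicator C j ℕ.* f j) ≡ 0
      no-start f≡0 = sum-zeros λ j → trans (cong (indicator C j ℕ.*_) (f≡0 j)) (ℕₚ.*-zeroʳ (indicator C j))

  sum-indicator-* : ∀ {n} (C : Subset n) → sumℕ (λ j → indicator C j ℕ.* 1) ≡ ∣ C ∣
  sum-indicator-* C = trans (sum-cong-≗ λ j → ℕₚ.*-identityʳ (indicator C j)) (sum-indicator C)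

  ascents-ordering : Ordering (λ j₁ j₂ → does (j₁ <? j₂)) ascents
  ascents-ordering = record { order-suc = λ _ _ → refl ; counts = counts }
    where
    counts : ∀ {n} (V C : Subset n) →
             sumℕ (λ j₁ → indicator V j₁ ℕ.* sumℕ (λ j₂ → indicator C j₂ ℕ.* bit (does (j₁ <? j₂)))) ≡ ascents V C
    counts []      []      = refl
    counts (v ∷ V) (c ∷ C) = cong₂ ℕ._+_
      (cong (bit v ℕ.*_) (cong₂ ℕ._+_ (ℕₚ.*-zeroʳ (bit c)) (sum-indicator-* C)))
      (trans (sum-cong-≗ λ j₁ → cong (λ k → indicator V j₁ ℕ.* (k ℕ.+ sumℕ (λ j₂ → indicator C j₂ ℕ.* bit (does (j₁ <? j₂))))) (ℕₚ.*-zeroʳ (bit c))) (counts V C))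

  descents-ordering : Ordering (λ j₁ j₂ → does (j₂ <? j₁)) descents
  descents-ordering = record { order-suc = λ _ _ → refl ; counts = counts }
    where
    counts : ∀ {n} (V C : Subset n) →
             sumℕ (λ j₁ → indicator V j₁ ℕ.* sumℕ (λ j₂ → indicator C j₂ ℕ.* bit (does (j₂ <? j₁)))) ≡ descents V C
    counts {n} V C = begin
      sumℕ (λ j₁ → indicator V j₁ ℕ.* sumℕ (λ j₂ → indicator C j₂ ℕ.* bit (does (j₂ <? j₁))))
        ≡⟨ sum-cong-≗ (λ j₁ → *-distribˡ-sum {n} (indicator V j₁) _) ⟩
      sumℕ (λ j₁ → sumℕ (λ j₂ → indicator V j₁ ℕ.* (indicator C j₂ ℕ.* bit (does (j₂ <? j₁)))))
        ≡⟨ ∑-comm {n} {n} _ ⟩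
      sumℕ (λ j₂ → sumℕ (λ j₁ → indicator V j₁ ℕ.* (indicator C j₂ ℕ.* bit (does (j₂ <? j₁)))))
        ≡⟨ sum-cong-≗ (λ j₂ → sum-cong-≗ λ j₁ → exchange (indicator V j₁) (indicator C j₂) _) ⟩
      sumℕ (λ j₂ → sumℕ (λ j₁ → indicator C j₂ ℕ.* (indicator V j₁ ℕ.* bit (does (j₂ <? j₁)))))
        ≡⟨ sum-cong-≗ (λ j₂ → sym (*-distribˡ-sum {n} (indicator C j₂) _)) ⟩
      sumℕ (λ j₂ → indicator C j₂ ℕ.* sumℕ (λ j₁ → indicator V j₁ ℕ.* bit (does (j₂ <? j₁))))
        ≡⟨ Ordering.counts ascents-ordering C V ⟩
      ascents C V ∎
      where
      exchange : ∀ a b c → a ℕ.* (b ℕ.* c) ≡ b ℕ.* (a ℕ.* c)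
      exchange a b c = trans (sym (ℕₚ.*-assoc a b c)) (trans (cong (ℕ._* c) (ℕₚ.*-comm a b)) (ℕₚ.*-assoc b a c))

  cr₂-pairs : ∀ {n} (π : List (Subset n)) (c : Triangle n) → (∀ i j → isArcᵇ π i j ≡ entry c i j) →
              cr₂ π ≡ Statistic.arcPairs ascents c
  cr₂-pairs π c π≡c = trans (length-arcPairs π c π≡c crossing?) (arcPairs-sum ascents-ordering c)

  ne₂-pairs : ∀ {n} (π : List (Subset n)) (c : Triangle n) → (∀ i j → isArcᵇ π i j ≡ entry c i j) →
              ne₂ π ≡ Statistic.arcPairs descents c
  ne₂-pairs π c π≡c = begin
    ne₂ π
      ≡⟨ length-arcPairs π c π≡c nesting? ⟩
    arcPairSum (λ p → does (nesting? p)) c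
      -- The definition of a nesting asks for i₂ < j₂ where `straddle` asks for i₂ < j₁. For an
      -- actual arc i₂ < j₂ always holds, and j₂ < j₁ then gives i₂ < j₁.
      ≡⟨ arcSum-cong c (λ i₁ j₁ _ → arcSum-cong c λ i₂ j₂ e → cong (λ b → bit (does (i₁ <? i₂) ∧ b)) (enclosed i₂ j₁ j₂ (entry⇒< c i₂ j₂ e))) ⟩
    arcPairSum (λ ((i₁ , j₁) , (i₂ , j₂)) → does (i₁ <? i₂) ∧ (does (i₂ <? j₁) ∧ does (j₂ <? j₁))) c
      ≡⟨ arcPairs-sum descents-ordering c ⟩
    Statistic.arcPairs descents c ∎
    where
    enclosed : ∀ {n} (i₂ j₁ j₂ : Fin n) → i₂ Fin.< j₂ →
               does (i₂ <? j₂) ∧ does (j₂ <? j₁) ≡ does (i₂ <? j₁) ∧ does (j₂ <? j₁)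
    enclosed i₂ j₁ j₂ i₂<j₂ with j₂ <? j₁
    ... | yes j₂<j₁ = cong (_∧ does (j₂ <? j₁)) (trans (dec-true (i₂ <? j₂) i₂<j₂) (sym (dec-true (i₂ <? j₁) (<-trans i₂<j₂ j₂<j₁))))
    ... | no  j₂≮j₁ = trans (absorbed (does (i₂ <? j₂))) (sym (absorbed (does (i₂ <? j₁))))
      where
      absorbed : ∀ b → b ∧ does (j₂ <? j₁) ≡ false
      absorbed b = trans (cong (b ∧_) (dec-false (j₂ <? j₁) j₂≮j₁)) (Boolₚ.∧-zeroʳ b)

open ArcCounts

-- The bijection between linked partitions and arc matrices

module LinkedPartitions where
  open ≡ using (refl; sym; trans; cong; cong₂; subst; module ≡-Reasoning)
  open CommutativeMonoidSum ℕₚ.+-0-commutativeMonoid using (sum-cong-≗)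

  -- Sublists as representatives of sets, and permutations from bijections

  module _ {a} {A : Set a} where

    ∈-sublists⁻ : ∀ (L : List A) {M} → M ∈ˡ sublists L → ∀ {z} → z ∈ˡ M → z ∈ˡ L
    ∈-sublists⁻ []      (here refl) ()
    ∈-sublists⁻ (w ∷ L) M∈ z∈ with ∈-++⁻ (map (w ∷_) (sublists L)) M∈
    ... | inj₂ M∈′ = there (∈-sublists⁻ L M∈′ z∈)
    ... | inj₁ wM∈ with M′ , M′∈ , refl ← ∈-map⁻ (w ∷_) wM∈ with z∈
    ...   | here z≡w = here z≡w
    ...   | there z∈′ = there (∈-sublists⁻ L M′∈ z∈′)

    sublists-unique : ∀ {L : List A} → Unique L → Unique (sublists L)
    sublists-unique []                         = [] ∷ []
    sublists-unique {w ∷ L} (w∉L ∷ unique) = Uniqueₚ.++⁺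
      (Uniqueₚ.map⁺ (λ { refl → refl }) (sublists-unique unique)) (sublists-unique unique) disjoint
      where
      disjoint : ∀ {M} → ¬ (M ∈ˡ map (w ∷_) (sublists L) × M ∈ˡ sublists L)
      disjoint (wM∈ , M∈) with _ , _ , refl ← ∈-map⁻ (w ∷_) wM∈ = All.lookup w∉L (∈-sublists⁻ L M∈ (here refl)) refl

    filter-∈-sublists : ∀ {p} {P : Pred A p} (P? : Decidable P) (L : List A) → filter P? L ∈ˡ sublists L
    filter-∈-sublists P? []      = here refl
    filter-∈-sublists P? (w ∷ L) with does (P? w)
    ... | true  = ∈-++⁺ˡ (∈-map⁺ (w ∷_) (filter-∈-sublists P? L))
    ... | false = ∈-++⁺ʳ (map (w ∷_) (sublists L)) (filter-∈-sublists P? L)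

    -- A sublist of a duplicate-free list is determined by its elements. Equality of linked
    -- partitions thus reduces to having the same blocks.
    sublist-filter : ∀ {p} {P : Pred A p} (P? : Decidable P) {L : List A} → Unique L → ∀ {M} → M ∈ˡ sublists L →
                     (∀ {z} → z ∈ˡ M → P z) → (∀ {z} → z ∈ˡ L → P z → z ∈ˡ M) → filter P? L ≡ M
    sublist-filter P? []                       (here refl) sound complete = refl
    sublist-filter P? {w ∷ L} (w∉L ∷ unique) M∈ sound complete with ∈-++⁻ (map (w ∷_) (sublists L)) M∈
    ... | inj₁ wM∈ with M′ , M′∈ , refl ← ∈-map⁻ (w ∷_) wM∈ =
      trans (filter-accept P? (sound (here refl))) (cong (w ∷_) (sublist-filter P? unique M′∈ (sound ∘ there) complete′))
      where
      complete′ : ∀ {z} → z ∈ˡ L → _ → z ∈ˡ M′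
      complete′ z∈ Pz with complete (there z∈) Pz
      ... | here refl = contradiction refl (All.lookup w∉L z∈)
      ... | there z∈′ = z∈′
    ... | inj₂ M∈′ =
      trans (filter-reject P? (λ Pw → All.lookup w∉L (∈-sublists⁻ L M∈′ (complete (here refl) Pw)) refl))
            (sublist-filter P? unique M∈′ sound (complete ∘ there))

  map-unique : ∀ {a b} {A : Set a} {B : Set b} (f : A → B) (L : List A) →
               (∀ {z w} → z ∈ˡ L → w ∈ˡ L → f z ≡ f w → z ≡ w) → Unique L → Unique (map f L)
  map-unique f []      injective []               = []
  map-unique f (z ∷ L) injective (z∉L ∷ unique) =
    Allₚ.map⁺ (All.tabulate λ w∈ fz≡fw → All.lookup z∉L w∈ (injective (here refl) (there w∈) fz≡fw))
    ∷ map-unique f L (λ z∈ w∈ → injective (there z∈) (there w∈)) unique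

  -- Duplicate-free lists with the same elements are permutations of each other, so mutually inverse
  -- maps suffice and no order of enumeration has to be matched.
  bijection⇒↭ : ∀ {a b} {A : Set a} {B : Set b} {L : List A} {M : List B} → Unique L → Unique M →
                (f : A → B) (g : B → A) →
                (∀ {z} → z ∈ˡ L → f z ∈ˡ M) → (∀ {w} → w ∈ˡ M → g w ∈ˡ L) →
                (∀ {z} → z ∈ˡ L → g (f z) ≡ z) → (∀ {w} → w ∈ˡ M → f (g w) ≡ w) →
                map f L ↭ M
  bijection⇒↭ {L = L} {M} uniqueL uniqueM f g f∈ g∈ gf fg = ∼bag⇒↭ (unique∧set⇒bag
    (map-unique f L (λ z∈ w∈ eq → trans (sym (gf z∈)) (trans (cong g eq) (gf w∈))) uniqueL) uniqueM
    (mk⇔ to from))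
    where
    to : ∀ {w} → w ∈ˡ map f L → w ∈ˡ M
    to w∈ with _ , z∈ , refl ← ∈-map⁻ f w∈ = f∈ z∈
    from : ∀ {w} → w ∈ˡ M → w ∈ˡ map f L
    from w∈ = subst (_∈ˡ map f L) (fg w∈) (∈-map⁺ f (g∈ w∈))

  allSubsets-unique : ∀ n → Unique (allSubsets n)
  allSubsets-unique zero    = [] ∷ []
  allSubsets-unique (suc n) = Uniqueₚ.++⁺
    (Uniqueₚ.map⁺ (λ { refl → refl }) (allSubsets-unique n))
    (Uniqueₚ.map⁺ (λ { refl → refl }) (allSubsets-unique n))
    disjoint
    where
    disjoint : ∀ {E} → ¬ (E ∈ˡ map (inside ∷_) (allSubsets n) × E ∈ˡ map (outside ∷_) (allSubsets n))
    disjoint (p , p′) with _ , _ , refl ← ∈-map⁻ (inside ∷_) p with _ , _ , () ← ∈-map⁻ (outside ∷_) p′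

  ∈-allSubsets : ∀ {n} (E : Subset n) → E ∈ˡ allSubsets n
  ∈-allSubsets []                  = here refl
  ∈-allSubsets (inside ∷ E)        = ∈-++⁺ˡ (∈-map⁺ (inside ∷_) (∈-allSubsets E))
  ∈-allSubsets {suc n} (outside ∷ E) = ∈-++⁺ʳ (map (inside ∷_) (allSubsets n)) (∈-map⁺ (outside ∷_) (∈-allSubsets E))

  nonempty⇒min : ∀ {n} {E : Subset n} → Nonempty E → ∃ λ i → IsMin i E
  nonempty⇒min {E = inside ∷ E}  _                  = zero , here , λ _ _ → ℕ.z≤n
  nonempty⇒min {E = outside ∷ E} (suc k , there k∈) with i , i∈ , min ← nonempty⇒min (k , k∈) =
    suc i , there i∈ , λ { (suc k) (there k∈) → ℕ.s≤s (min k k∈) }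

  min-unique : ∀ {n} {E : Subset n} {i j} → IsMin i E → IsMin j E → i ≡ j
  min-unique (i∈ , i≤) (j∈ , j≤) = ≤-antisym (i≤ _ j∈) (j≤ _ i∈)

  distinct⇒2≤∣∣ : ∀ {n} {E : Subset n} {i j} → i ∈ E → j ∈ E → j ≢ i → 2 ℕ.≤ ∣ E ∣
  distinct⇒2≤∣∣ {E = E} {i} i∈ j∈ j≢i =
    ℕₚ.≤-trans (ℕ.s≤s (ℕₚ.≤-trans (ℕ.s≤s ℕ.z≤n) (x∈p⇒∣p-x∣<∣p∣ (x∈p∧x≢y⇒x∈p-y j∈ j≢i)))) (x∈p⇒∣p-x∣<∣p∣ i∈)

  2≤∣∣⇒distinct : ∀ {n} {E : Subset n} i → 2 ℕ.≤ ∣ E ∣ → ∃ λ j → j ∈ E × j ≢ i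
  2≤∣∣⇒distinct {E = E} i 2≤∣E∣ = decidable-stable (any? λ j → (j ∈? E) ×-dec ¬? (j ≟ i)) λ none →
    ℕₚ.<⇒≱ 2≤∣E∣ (ℕₚ.≤-trans (p⊆q⇒∣p∣≤∣q∣ (E⊆⁅i⁆ none)) (ℕₚ.≤-reflexive (∣⁅x⁆∣≡1 i)))
    where
    E⊆⁅i⁆ : ¬ (∃ λ j → j ∈ E × j ≢ i) → ∀ {j} → j ∈ E → j ∈ ⁅ i ⁆
    E⊆⁅i⁆ none {j} j∈ with j ≟ i
    ... | yes refl = x∈⁅x⁆ i
    ... | no  j≢i  = contradiction (j , j∈ , j≢i) none

  sum-bits≤1 : ∀ {n} (f : Fin n → Bool) → sumℕ (λ i → bit (f i)) ℕ.≤ 1 → ∀ {i k} → f i ≡ true → f k ≡ true → i ≡ k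
  sum-bits≤1 f sum≤1 {i} {k} fi fk with i ≟ k
  ... | yes i≡k = i≡k
  ... | no  i≢k = contradiction (distinct⇒2≤∣∣ (member fk) (member fi) i≢k) (ℕₚ.<⇒≱ (ℕ.s≤s ∣f∣≤1))
    where
    member : ∀ {j} → f j ≡ true → j ∈ tabulate f
    member {j} fj = Vecₚ.lookup⇒[]= j _ (trans (Vecₚ.lookup∘tabulate f j) fj)
    ∣f∣≤1 : ∣ tabulate f ∣ ℕ.≤ 1
    ∣f∣≤1 = subst (ℕ._≤ 1) (trans (sum-cong (λ j → cong bit (sym (Vecₚ.lookup∘tabulate f j)))) (sum-indicator (tabulate f))) sum≤1
      where sum-cong : ∀ {g h : Fin _ → ℕ} → (∀ j → g j ≡ h j) → sumℕ g ≡ sumℕ h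
            sum-cong = sum-cong-≗

  module Blocks {n} (A : Fin n → Fin n → Bool) where

    block : Fin n → Subset n
    block i = tabulate (λ j → does (i ≟ j) ∨ A i j)

    -- A vertex that is a right endpoint but not a left one is the minimum of no block.
    Present : Fin n → Set
    Present i = (∃ λ j → A i j ≡ true) ⊎ (∀ k → A k i ≡ false)

    IsBlock : Subset n → Set
    IsBlock E = ∃ λ i → E ≡ block i × Present i

    isBlock? : Decidable IsBlock
    isBlock? E = any? λ i → Vecₚ.≡-dec Boolₚ._≟_ E (block i)
      ×-dec (any? (λ j → A i j Boolₚ.≟ true) ⊎-dec all? (λ k → A k i Boolₚ.≟ false))

    lookup-block : ∀ i j → lookup (block i) j ≡ does (i ≟ j) ∨ A i j
    lookup-block i = Vecₚ.lookup∘tabulate _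

    self∈block : ∀ i → i ∈ block i
    self∈block i = Vecₚ.lookup⇒[]= i _ (trans (lookup-block i i) (cong (_∨ A i i) (dec-true (i ≟ i) refl)))

    arc∈block : ∀ {i j} → A i j ≡ true → j ∈ block i
    arc∈block {i} {j} Aij = Vecₚ.lookup⇒[]= j _
      (trans (lookup-block i j) (trans (cong (does (i ≟ j) ∨_) Aij) (Boolₚ.∨-zeroʳ (does (i ≟ j)))))

    ∈block⁻ : ∀ {i j} → j ∈ block i → j ≡ i ⊎ A i j ≡ true
    ∈block⁻ {i} {j} j∈ with i ≟ j
    ... | yes i≡j = inj₁ (sym i≡j)
    ... | no  i≢j = inj₂ (trans (cong (_∨ A i j) (sym (dec-false (i ≟ j) i≢j)))
                                (trans (sym (lookup-block i j)) (Vecₚ.[]=⇒lookup j∈)))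

  record Represents {n} (A : Fin n → Fin n → Bool) (π : List (Subset n)) : Set where
    field
      sound    : ∀ {i j} → A i j ≡ true → IsArc π (i , j)
      complete : ∀ {i j} → IsArc π (i , j) → A i j ≡ true

    isArcᵇ≡ : ∀ i j → isArcᵇ π i j ≡ A i j
    isArcᵇ≡ i j with A i j in eq
    ... | true  = dec-true (isArc? π (i , j)) (sound eq)
    ... | false = dec-false (isArc? π (i , j)) λ arc → case (trans (sym eq) (complete arc))
      where case : false ≡ true → _
            case ()

  isArc⇒< : ∀ {n} {π : List (Subset n)} {i j} → IsArc π (i , j) → i Fin.< j
  isArc⇒< arc with E , _ , _ , (_ , min) , j∈ , j≢i ← find arc = ≤∧≢⇒< (min _ j∈) (j≢i ∘ sym)

  -- Recovering a linked partition from its arcs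

  module _ {n} {π : List (Subset n)} (linked : IsLinkedPartition π)
           {A : Fin n → Fin n → Bool} (represents : Represents A π) where
    open IsLinkedPartition linked
    open Represents represents
    open Blocks A

    private
      near : ∀ {E F} → E ∈ˡ π → F ∈ˡ π → E ≢ F → NearlyDisjoint E F
      near E∈ F∈ = All.lookup (All.lookup nearlyDisjoint E∈) F∈

      same-min : ∀ {E F i} → E ∈ˡ π → F ∈ˡ π → IsMin i E → IsMin i F → E ≡ F
      same-min {E} {F} {i} E∈ F∈ minE minF = decidable-stable (Vecₚ.≡-dec Boolₚ._≟_ E F) λ E≢F →
        case (near E∈ F∈ E≢F i (x∈p∩q⁺ (proj₁ minE , proj₁ minF)))
        where
        case : _ ⊎ _ → _
        case (inj₁ (_ , _ , ¬minF)) = ¬minF minF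
        case (inj₂ (_ , _ , ¬minE)) = ¬minE minE

    block-of-min : ∀ {F i} → F ∈ˡ π → IsMin i F → F ≡ block i
    block-of-min {F} {i} F∈ minF = ⊆-antisym to from
      where
      to : ∀ {j} → j ∈ F → j ∈ block i
      to {j} j∈ with j ≟ i
      ... | yes refl = self∈block i
      ... | no  j≢i  = arc∈block (complete (lose F∈ (distinct⇒2≤∣∣ (proj₁ minF) j∈ j≢i , minF , j∈ , j≢i)))
      from : ∀ {j} → j ∈ block i → j ∈ F
      from j∈ with ∈block⁻ j∈
      ... | inj₁ refl = proj₁ minF
      ... | inj₂ Aij with E , E∈ , _ , minE , j∈E , _ ← find (sound Aij) with refl ← same-min E∈ F∈ minE minF = j∈E

    -- A block with at least two elements yields an arc from its minimum. If `F` is a singleton, an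
    -- arc from k to i is impossible: near disjointness would require i to be the minimum of the
    -- block of k, or `F` to have more than one element.
    min-present : ∀ {F i} → F ∈ˡ π → IsMin i F → Present i
    min-present {F} {i} F∈ minF with 2 ℕ.≤? ∣ F ∣
    ... | yes 2≤∣F∣ with j , j∈ , j≢i ← 2≤∣∣⇒distinct i 2≤∣F∣ = inj₁ (j , complete (lose F∈ (2≤∣F∣ , minF , j∈ , j≢i)))
    ... | no  2≰∣F∣ = inj₂ λ k → Boolₚ.¬-not λ Aki → no-parent k (sound Aki)
      where
      no-parent : ∀ k → ¬ IsArc π (k , i)
      no-parent k arc with E , E∈ , 2≤∣E∣ , minE , i∈E , i≢k ← find arc
        with near E∈ F∈ (λ { refl → 2≰∣F∣ 2≤∣E∣ }) i (x∈p∩q⁺ (i∈E , proj₁ minF))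
      ... | inj₁ (minE′ , _)      = i≢k (min-unique minE′ minE)
      ... | inj₂ (_ , 2≤∣F∣ , _)  = 2≰∣F∣ 2≤∣F∣

    ∈⇒isBlock : ∀ {E} → E ∈ˡ π → IsBlock E
    ∈⇒isBlock E∈ with i , min ← nonempty⇒min (All.lookup nonempty E∈) = i , block-of-min E∈ min , min-present E∈ min

    -- A vertex with an outgoing arc is the minimum of the block that carries the arc. One without
    -- an incoming arc lies in some block by `covers` and is its minimum, since otherwise that block
    -- would produce an arc ending there.
    isBlock⇒∈ : ∀ {E} → IsBlock E → E ∈ˡ π
    isBlock⇒∈ (i , refl , inj₁ (j , Aij)) with F , F∈ , _ , minF , _ ← find (sound Aij) = subst (_∈ˡ π) (block-of-min F∈ minF) F∈
    isBlock⇒∈ (i , refl , inj₂ orphan) with F , F∈ , i∈F ← find (covers i)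
      with k , minF ← nonempty⇒min (All.lookup nonempty F∈) with i ≟ k
    ... | yes refl = subst (_∈ˡ π) (block-of-min F∈ minF) F∈
    ... | no  i≢k  = contradiction (complete (lose F∈ (distinct⇒2≤∣∣ (proj₁ minF) i∈F i≢k , minF , i∈F , i≢k))) (Boolₚ.not-¬ (orphan k))

  -- Linked partitions from arc sets with at most one incoming arc per vertex

  module _ {n} {A : Fin n → Fin n → Bool}
           (A⇒< : ∀ {i j} → A i j ≡ true → i Fin.< j)
           (A-functional : ∀ {i k j} → A i j ≡ true → A k j ≡ true → i ≡ k)
           {π : List (Subset n)}
           (∈⇒block : ∀ {E} → E ∈ˡ π → Blocks.IsBlock A E)
           (block⇒∈ : ∀ {E} → Blocks.IsBlock A E → E ∈ˡ π) where
    open Blocks A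

    block-min : ∀ i → IsMin i (block i)
    block-min i = self∈block i , λ k k∈ → smallest (∈block⁻ k∈)
      where
      smallest : ∀ {k} → k ≡ i ⊎ A i k ≡ true → i Fin.≤ k
      smallest (inj₁ refl) = ≤-refl
      smallest (inj₂ Aik)  = ℕₚ.<⇒≤ (A⇒< Aik)

    arc-2≤∣block∣ : ∀ {i j} → A i j ≡ true → 2 ℕ.≤ ∣ block i ∣
    arc-2≤∣block∣ {i} {j} Aij = distinct⇒2≤∣∣ (self∈block i) (arc∈block Aij) (<⇒≢ (A⇒< Aij) ∘ sym)

    -- A vertex that has a parent and also a block of its own must have a child. Its block then has
    -- at least two elements, as the definition of near disjointness demands of the block whose
    -- minimum is shared.
    child-nearlyDisjoint : ∀ {i j} → Present i → A j i ≡ true →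
                           IsMin i (block i) × 1 ℕ.< ∣ block i ∣ × ¬ IsMin i (block j)
    child-nearlyDisjoint (inj₁ (_ , Aik)) Aji = block-min _ , arc-2≤∣block∣ Aik , λ min → <⇒≢ (A⇒< Aji) (min-unique (block-min _) min)
    child-nearlyDisjoint (inj₂ orphan)    Aji = contradiction Aji (Boolₚ.not-¬ (orphan _))

    -- A common element is the minimum or a child in each block. Being a child in both would give it
    -- two parents, being the minimum of both would make the blocks equal, and the mixed cases are
    -- the permitted ones.
    blocks-nearlyDisjoint : ∀ {i j} → Present i → Present j → block i ≢ block j → NearlyDisjoint (block i) (block j)
    blocks-nearlyDisjoint {i} {j} pi pj i≢j k k∈ with x∈p∩q⁻ (block i) (block j) k∈
    ... | k∈i , k∈j with ∈block⁻ k∈i | ∈block⁻ k∈j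
    ...   | inj₁ refl | inj₁ refl = contradiction refl i≢j
    ...   | inj₁ refl | inj₂ Aji  = inj₁ (child-nearlyDisjoint pi Aji)
    ...   | inj₂ Aij  | inj₁ refl = inj₂ (child-nearlyDisjoint pj Aij)
    ...   | inj₂ Aik  | inj₂ Ajk  = contradiction (cong block (A-functional Aik Ajk)) i≢j

    blocks-linked : IsLinkedPartition π
    blocks-linked = record
      { nonempty       = All.tabulate λ E∈ → nonempty (∈⇒block E∈)
      ; covers         = covers
      ; nearlyDisjoint = All.tabulate λ E∈ → All.tabulate λ F∈ → near (∈⇒block E∈) (∈⇒block F∈)
      }
      where
      nonempty : ∀ {E} → IsBlock E → Nonempty E
      nonempty (i , refl , _) = i , self∈block i
      near : ∀ {E F} → IsBlock E → IsBlock F → E ≢ F → NearlyDisjoint E F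
      near (i , refl , pi) (j , refl , pj) = blocks-nearlyDisjoint pi pj
      covers : ∀ i → Any (i ∈_) π
      covers i with any? (λ k → A k i Boolₚ.≟ true)
      ... | yes (k , Aki) = lose (block⇒∈ (k , refl , inj₁ (i , Aki))) (arc∈block Aki)
      ... | no  orphan    = lose (block⇒∈ (i , refl , inj₂ λ k → Boolₚ.¬-not λ Aki → orphan (k , Aki))) (self∈block i)

    blocks-represents : Represents A π
    blocks-represents = record
      { sound    = λ {i} {j} Aij → lose (block⇒∈ (i , refl , inj₁ (j , Aij)))
                     (arc-2≤∣block∣ Aij , block-min i , arc∈block Aij , <⇒≢ (A⇒< Aij) ∘ sym)
      ; complete = λ arc → complete (find arc)
      }
      where
      complete : ∀ {i j} → ∃ (λ E → E ∈ˡ π × 2 ℕ.≤ ∣ E ∣ × IsMin i E × j ∈ E × j ≢ i) → A i j ≡ true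
      complete (E , E∈ , _ , minE , j∈ , j≢i) with k , refl , _ ← ∈⇒block E∈ with refl ← min-unique minE (block-min k) with ∈block⁻ j∈
      ... | inj₁ j≡i = contradiction j≡i j≢i
      ... | inj₂ Aij = Aij

  toTriangle : ∀ {n} → (Fin n → Fin n → Bool) → Triangle n
  toTriangle {zero}  A = []
  toTriangle {suc n} A = tabulate (λ j → A zero (suc j)) ∷ toTriangle (λ i j → A (suc i) (suc j))

  entry-toTriangle : ∀ {n} (A : Fin n → Fin n → Bool) → (∀ i j → A i j ≡ true → i Fin.< j) →
                     ∀ i j → entry (toTriangle A) i j ≡ A i j
  entry-toTriangle A A⇒< i       zero    = sym (Boolₚ.¬-not λ Ai0 → contradiction (A⇒< i zero Ai0) λ ())
  entry-toTriangle A A⇒< zero    (suc j) = Vecₚ.lookup∘tabulate _ j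
  entry-toTriangle A A⇒< (suc i) (suc j) = entry-toTriangle (λ i j → A (suc i) (suc j)) (λ i j Aij → ℕ.s≤s⁻¹ (A⇒< (suc i) (suc j) Aij)) i j

  toTriangle-entry : ∀ {n} (A : Fin n → Fin n → Bool) (c : Triangle n) → (∀ i j → A i j ≡ entry c i j) → toTriangle A ≡ c
  toTriangle-entry A []      A≡c = refl
  toTriangle-entry A (C ∷ c) A≡c = cong₂ _∷_
    (trans (Vecₚ.tabulate-cong λ j → A≡c zero (suc j)) (Vecₚ.tabulate∘lookup C))
    (toTriangle-entry _ c λ i j → A≡c (suc i) (suc j))

  arcTriangle : ∀ {n} → List (Subset n) → Triangle n
  arcTriangle π = toTriangle (isArcᵇ π)

  isArcᵇ⇒isArc : ∀ {n} (π : List (Subset n)) i j → isArcᵇ π i j ≡ true → IsArc π (i , j)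
  isArcᵇ⇒isArc π i j eq = decidable-stable (isArc? π (i , j)) λ ¬arc → contradiction eq (Boolₚ.not-¬ (dec-false (isArc? π (i , j)) ¬arc))

  entry-arcTriangle : ∀ {n} (π : List (Subset n)) i j → entry (arcTriangle π) i j ≡ isArcᵇ π i j
  entry-arcTriangle π = entry-toTriangle (isArcᵇ π) λ i j eq → isArc⇒< (isArcᵇ⇒isArc π i j eq)

  arcTriangle-represents : ∀ {n} (π : List (Subset n)) → Represents (entry (arcTriangle π)) π
  arcTriangle-represents π = record
    { sound    = λ {i} {j} eq → isArcᵇ⇒isArc π i j (trans (sym (entry-arcTriangle π i j)) eq)
    ; complete = λ {i} {j} arc → trans (entry-arcTriangle π i j) (dec-true (isArc? π (i , j)) arc)
    }

  blocks : ∀ {n} → Triangle n → List (Subset n)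
  blocks {n} c = filter (Blocks.isBlock? (entry c)) (allSubsets n)

  -- The linked partitions with given endpoints as complete partial diagrams

  module _ {n} (S : Multiset n) (T : Subset n) (∣T∣≡∣S∣ : ∣ T ∣ ≡ sumℕ S) where

    private
      LP? : Decidable λ π → IsLinkedPartition π × (left π ≐ S) × (right π ≐ asMultiset T)
      LP? π = isLinkedPartition? π ×-dec (left π ≐? S) ×-dec (right π ≐? asMultiset T)

      indicator-⊥ : ∀ {m} (j : Fin m) → indicator ⊥ j ≡ 0
      indicator-⊥ j = cong bit (Vecₚ.lookup-replicate j outside)

      empty : ∀ {m} (U : Subset m) → ∣ U ∣ ≡ 0 → U ≡ ⊥
      empty []            eq = refl
      empty (outside ∷ U) eq = cong (outside ∷_) (empty U eq)

      -- Here the equality of the sizes of `S` and `T` enters: a diagram on all vertices has drawn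
      -- |S| arcs, which use up all of `T`.
      leftover : ∀ {c U} → Partial S T c U → U ≡ ⊥
      leftover {c} {U} p = empty U (ℕₚ.+-cancelˡ-≡ (sumℕ S) _ _
        (trans (partial-size p) (trans ∣T∣≡∣S∣ (sym (ℕₚ.+-identityʳ (sumℕ S))))))

      partial : ∀ {π} → π ∈ˡ LP n S T → Partial S T (arcTriangle π) ⊥
      partial {π} π∈ with _ , _ , leftS , rightT ← ∈-filter⁻ LP? {xs = sublists (allSubsets n)} π∈ = partial⁺ S T ⊥ (arcTriangle π)
        (λ i → trans (sum-cong-≗ λ j → cong bit (entry-arcTriangle π i j)) (trans (sym (left-row π i)) (leftS i)))
        (λ j → begin
          sumℕ (λ i → bit (entry (arcTriangle π) i j)) ℕ.+ indicator ⊥ j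
            ≡⟨ cong₂ ℕ._+_ (sum-cong-≗ λ i → cong bit (entry-arcTriangle π i j)) (indicator-⊥ j) ⟩
          sumℕ (λ i → bit (isArcᵇ π i j)) ℕ.+ 0   ≡⟨ ℕₚ.+-identityʳ _ ⟩
          sumℕ (λ i → bit (isArcᵇ π i j))         ≡⟨ right-column π j ⟨
          right π j                               ≡⟨ rightT j ⟩
          asMultiset T j                          ≡⟨ asMultiset≗indicator T j ⟩
          indicator T j                           ∎)
        where open ≡-Reasoning

      module FromPartial {c : Triangle n} (p : Partial S T c ⊥) where
        open ≡-Reasoning

        column : ∀ j → sumℕ (λ i → bit (entry c i j)) ≡ indicator T j
        column j = begin
          sumℕ (λ i → bit (entry c i j))                   ≡⟨ ℕₚ.+-identityʳ _ ⟨
          sumℕ (λ i → bit (entry c i j)) ℕ.+ 0             ≡⟨ cong (sumℕ (λ i → bit (entry c i j)) ℕ.+_) (indicator-⊥ j) ⟨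
          sumℕ (λ i → bit (entry c i j)) ℕ.+ indicator ⊥ j ≡⟨ partial-columns p j ⟩
          indicator T j                                    ∎

        functional : ∀ {i k j} → entry c i j ≡ true → entry c k j ≡ true → i ≡ k
        functional {j = j} = sum-bits≤1 (λ i → entry c i j) (subst (ℕ._≤ 1) (sym (column j)) (bit≤1 (lookup T j)))

        ∈⇒block : ∀ {E} → E ∈ˡ blocks c → Blocks.IsBlock (entry c) E
        ∈⇒block E∈ = proj₂ (∈-filter⁻ (Blocks.isBlock? (entry c)) {xs = allSubsets n} E∈)

        block⇒∈ : ∀ {E} → Blocks.IsBlock (entry c) E → E ∈ˡ blocks c
        block⇒∈ {E} = ∈-filter⁺ (Blocks.isBlock? (entry c)) (∈-allSubsets E)

        linked : IsLinkedPartition (blocks c)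
        linked = blocks-linked (λ {i} {j} → entry⇒< c i j) functional ∈⇒block block⇒∈

        represents : Represents (entry c) (blocks c)
        represents = blocks-represents (λ {i} {j} → entry⇒< c i j) functional ∈⇒block block⇒∈

        open Represents represents using (isArcᵇ≡) public

        blocks∈LP : blocks c ∈ˡ LP n S T
        blocks∈LP = ∈-filter⁺ LP? (filter-∈-sublists (Blocks.isBlock? (entry c)) (allSubsets n))
          ( linked
          , (λ i → trans (left-row (blocks c) i) (trans (sum-cong-≗ λ j → cong bit (isArcᵇ≡ i j)) (partial-rows p i)))
          , (λ j → trans (right-column (blocks c) j) (trans (sum-cong-≗ λ i → cong bit (isArcᵇ≡ i j))
                     (trans (column j) (sym (asMultiset≗indicator T j))))))

    -- The inverse maps are `arcTriangle` and `blocks`. One round trip holds because a partition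
    -- contains exactly the blocks described by its arcs, the other because the arcs of `blocks c`
    -- are the entries of `c`.
    LP↭partials : map (λ π → arcTriangle π , ⊥) (LP n S T) ↭ partials S T
    LP↭partials = bijection⇒↭
      (Uniqueₚ.filter⁺ LP? (sublists-unique (allSubsets-unique n)))
      (partials-unique S T)
      (λ π → arcTriangle π , ⊥) (blocks ∘ proj₁)
      (∈-partials⁺ ∘ partial)
      (λ {w} w∈ → FromPartial.blocks∈LP (complete w∈))
      (λ {π} π∈ → let π∈sublists , linked , _ = ∈-filter⁻ LP? {xs = sublists (allSubsets n)} π∈ in
        sublist-filter (Blocks.isBlock? (entry (arcTriangle π))) (allSubsets-unique n) π∈sublists
          (∈⇒isBlock linked (arcTriangle-represents π)) (λ _ → isBlock⇒∈ linked (arcTriangle-represents π)))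
      (λ {w} w∈ → cong₂ _,_
        (toTriangle-entry _ (proj₁ w) (FromPartial.isArcᵇ≡ (complete w∈)))
        (sym (leftover (∈-partials⁻ S T w∈))))
      where
      complete : ∀ {w} → w ∈ˡ partials S T → Partial S T (proj₁ w) ⊥
      complete {c , U} w∈ with p ← ∈-partials⁻ S T w∈ = subst (Partial S T c) (leftover p) p

open LinkedPartitions

-- From all vertices to the support of the multiset

module Reindexing {c ℓ} (M : CommutativeMonoid c ℓ) where
  open CommutativeMonoid M
  open CommutativeMonoidSum M using (sum; sum-cong-≋; sum-replicate-zero; ∑-comm)
  open SetoidReasoning setoid

  sum-neutral : ∀ {n} (f : Fin n → Carrier) → (∀ i → f i ≈ ε) → sum f ≈ ε
  sum-neutral {n} f f≈ε = trans (sum-cong-≋ f≈ε) (sum-replicate-zero n)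

  sum-single : ∀ {n} (f : Fin n → Carrier) i → (∀ j → j ≢ i → f j ≈ ε) → sum f ≈ f i
  sum-single f zero    f≈ε = trans (∙-congˡ (sum-neutral (f ∘ suc) λ j → f≈ε (suc j) λ ())) (identityʳ _)
  sum-single f (suc i) f≈ε = trans (∙-cong (f≈ε zero λ ()) (sum-single (f ∘ suc) i λ j j≢i → f≈ε (suc j) λ { ≡.refl → j≢i ≡.refl })) (identityˡ _)

  module _ {m n} (a : Fin m → Fin n) (f : Fin n → Carrier) where

    at : Fin m → Fin n → Carrier
    at i v = if does (a i ≟ v) then f v else ε

    at-hit : ∀ {i v} → a i ≡ v → at i v ≈ f v
    at-hit {i} {v} eq = reflexive (≡.cong (if_then f v else ε) (dec-true (a i ≟ v) eq))

    at-miss : ∀ {i v} → a i ≢ v → at i v ≈ ε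
    at-miss {i} {v} neq = reflexive (≡.cong (if_then f v else ε) (dec-false (a i ≟ v) neq))

    -- Each value is spread over its fibre under `a`, which has at most one element, and the double
    -- sum is exchanged. The monoid is arbitrary because the statement is needed both for the sum of
    -- multiplicities and for the product of factors.
    sum-reindex : (∀ {i j} → a i ≡ a j → i ≡ j) → (∀ v → ¬ (∃ λ i → a i ≡ v) → f v ≈ ε) → sum f ≈ sum (f ∘ a)
    sum-reindex injective outside-image = begin
      sum f                              ≈⟨ sum-cong-≋ fibre ⟩
      sum (λ v → sum (λ i → at i v))     ≈⟨ ∑-comm {n} {m} (λ v i → at i v) ⟩
      sum (λ i → sum (λ v → at i v))     ≈⟨ sum-cong-≋ (λ i → trans (sum-single (at i) (a i) λ v v≢ai → at-miss (v≢ai ∘ ≡.sym)) (at-hit {i} ≡.refl)) ⟩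
      sum (f ∘ a)                        ∎
      where
      fibre : ∀ v → f v ≈ sum (λ i → at i v)
      fibre v with any? (λ i → a i ≟ v)
      ... | yes (i , ≡.refl) = sym (trans (sum-single (λ k → at k v) i λ k k≢i → at-miss (k≢i ∘ injective)) (at-hit {i} ≡.refl))
      ... | no  ¬hit         = trans (outside-image v ¬hit) (sym (sum-neutral (λ k → at k v) λ k → at-miss λ eq → ¬hit (k , eq)))

module _ {m n} (a : Fin m → Fin n) (r : Fin m → ℕ) where
  open Reindexing ℕₚ.+-0-commutativeMonoid

  multiset-hit : (∀ {i j} → a i ≡ a j → i ≡ j) → ∀ i → multiset a r (a i) ≡ r i
  multiset-hit injective i = ≡.trans
    (sum-single (λ k → if does (a k ≟ a i) then r k else 0) i
      λ k k≢i → ≡.cong (if_then r k else 0) (dec-false (a k ≟ a i) (k≢i ∘ injective)))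
    (≡.cong (if_then r i else 0) (dec-true (a i ≟ a i) ≡.refl))

  multiset-miss : ∀ v → ¬ (∃ λ i → a i ≡ v) → multiset a r v ≡ 0
  multiset-miss v ¬hit = sum-neutral _ λ k → ≡.cong (if_then r k else 0) (dec-false (a k ≟ v) λ eq → ¬hit (k , eq))

  sum-multiset : (∀ {i j} → a i ≡ a j → i ≡ j) → sumℕ (multiset a r) ≡ sumℕ r
  sum-multiset injective = ≡.trans (sum-reindex a (multiset a r) injective multiset-miss)
    (sum-cong-≗ (multiset-hit injective))
    where open CommutativeMonoidSum ℕₚ.+-0-commutativeMonoid using (sum-cong-≗)

strictlyMonotone⇒injective : ∀ {m n} {a : Fin m → Fin n} → a Preserves _<_ ⟶ _<_ → ∀ {i j} → a i ≡ a j → i ≡ j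
strictlyMonotone⇒injective mono {i} {j} eq with <-cmp i j
... | tri< i<j _ _ = contradiction eq (<⇒≢ (mono i<j))
... | tri≈ _ i≡j _ = i≡j
... | tri> _ _ j<i = contradiction (≡.sym eq) (<⇒≢ (mono j<i))

ascents-⊥ˡ : ∀ {n} (C : Subset n) → ascents ⊥ C ≡ 0
ascents-⊥ˡ []      = ≡.refl
ascents-⊥ˡ (c ∷ C) = ascents-⊥ˡ C

ascents-⊥ʳ : ∀ {n} (C : Subset n) → ascents C ⊥ ≡ 0
ascents-⊥ʳ     []      = ≡.refl
ascents-⊥ʳ {suc n} (c ∷ C) = ≡.trans (≡.cong₂ (λ k l → bit c ℕ.* k ℕ.+ l) (∣⊥∣≡0 n) (ascents-⊥ʳ C)) (≡.cong (ℕ._+ 0) (ℕₚ.*-zeroʳ (bit c)))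

-- The generating function of crossings and nestings

module _ {c ℓ} (R : Indeterminates c ℓ) {n m : ℕ} (a : Fin m → Fin n) (r : Fin m → ℕ) (T : Subset n)
         (injective : ∀ {i j} → a i ≡ a j → i ≡ j) (∣T∣≡∣r∣ : ∣ T ∣ ≡ sumℕ r) where
  open Indeterminates R hiding (zero)
  open GaussianBinomials R
  open WeightedSums R
  open SetoidReasoning setoid

  private
    S : Multiset n
    S = multiset a r

  product-factors : product (λ v → factor (height S T v) (S v)) ≈ product (λ i → factor (height S T (a i)) (r i))
  product-factors = begin
    product (λ v → factor (height S T v) (S v))
      ≈⟨ sum-reindex a _ injective (λ v ¬hit → trans (reflexive (≡.cong (factor (height S T v)) (multiset-miss a r v ¬hit))) (factor-empty (height S T v))) ⟩
    product (λ i → factor (height S T (a i)) (S (a i)))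
      ≈⟨ sum-cong-≋ (λ i → reflexive (≡.cong (factor (height S T (a i))) (multiset-hit a r injective i))) ⟩
    product (λ i → factor (height S T (a i)) (r i)) ∎
    where
    open Reindexing *-commutativeMonoid using (sum-reindex)
    open CommutativeMonoidSum *-commutativeMonoid using (sum-cong-≋)

  LP-generatingFunction : ∀ {u v} → (∀ r s → PascalWeights u v r s) →
    sumOver (LP n S T) (λ π → u ^ cr₂ π * v ^ ne₂ π) ≈ product (λ i → factor (height S T (a i)) (r i))
  LP-generatingFunction {u} {v} weights = begin
    sumOver (LP n S T) (λ π → weight (cr₂ π) (ne₂ π))
      ≈⟨ sumOver-cong (LP n S T) (λ {π} _ → reflexive (≡.cong₂ weight (crossings π) (nestings π))) ⟩
    sumOver (LP n S T) (λ π → partialWeight (arcTriangle π , ⊥))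
      ≈⟨ sumOver-map (λ π → arcTriangle π , ⊥) (LP n S T) partialWeight ⟨
    sumOver (map (λ π → arcTriangle π , ⊥) (LP n S T)) partialWeight
      ≈⟨ sumOver-↭ (LP↭partials S T (≡.trans ∣T∣≡∣r∣ (≡.sym (sum-multiset a r injective)))) partialWeight ⟩
    sumOver (partials S T) partialWeight
      ≈⟨ sum-partials S T ⟩
    product (λ i → factor (height S T i) (S i))
      ≈⟨ product-factors ⟩
    product (λ i → factor (height S T (a i)) (r i)) ∎
    where
    open Weights u v weights
    crossings : ∀ π → cr₂ π ≡ Statistic.pairs ascents (arcTriangle π) ⊥
    crossings π = ≡.trans (cr₂-pairs π (arcTriangle π) λ i j → ≡.sym (entry-arcTriangle π i j))
                          (≡.sym (Statistic.pairs-⊥ ascents ascents-⊥ˡ (arcTriangle π)))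
    nestings : ∀ π → ne₂ π ≡ Statistic.pairs descents (arcTriangle π) ⊥
    nestings π = ≡.trans (ne₂-pairs π (arcTriangle π) λ i j → ≡.sym (entry-arcTriangle π i j))
                         (≡.sym (Statistic.pairs-⊥ descents ascents-⊥ʳ (arcTriangle π)))

theorem3p6 :
    ∀ {c ℓ} (R : Indeterminates c ℓ) (n m : ℕ) (a : Fin m → Fin n) (r : Fin m → ℕ) (T : Subset n) →
    1 ℕ.≤ n →
    a Preserves _<_ ⟶ _<_ →
    (∀ i → 1 ℕ.≤ r i) →
    ∣ T ∣ ≡ sumℕ r →
    let open Indeterminates R
        S = multiset a r
        h = λ i → height S T (a i)
    in  (sumOver (LP n S T) (λ π → x ^ cr₂ π * y ^ ne₂ π) ≈ sumOver (LP n S T) (λ π → x ^ ne₂ π * y ^ cr₂ π))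
      × (sumOver (LP n S T) (λ π → x ^ ne₂ π * y ^ cr₂ π) ≈ product (λ i → y^ (+ r i ℤ.* h i ℤ.- + (r i ℕ.* r i)) * qBinomial (h i) (r i)))
theorem3p6 R n m a r T _ mono _ ∣T∣≡∣r∣ = trans by-cr (sym by-ne) , by-ne
  where
  open Indeterminates R
  open GaussianBinomials R
  open WeightedSums R using (sumOver-cong)
  S = multiset a r
  injective : ∀ {i j} → a i ≡ a j → i ≡ j
  injective = strictlyMonotone⇒injective mono
  by-cr : sumOver (LP n S T) (λ π → x ^ cr₂ π * y ^ ne₂ π) ≈ product (λ i → factor (height S T (a i)) (r i))
  by-cr = LP-generatingFunction R a r T injective ∣T∣≡∣r∣ xy-weights
  by-ne : sumOver (LP n S T) (λ π → x ^ ne₂ π * y ^ cr₂ π) ≈ product (λ i → factor (height S T (a i)) (r i))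
  -- Now `u` is `y` and `v` is `x`, so crossings are marked by `y`; only the order of the two powers
  -- has to be exchanged.
  by-ne = trans (sumOver-cong (LP n S T) λ _ → *-comm _ _) (LP-generatingFunction R a r T injective ∣T∣≡∣r∣ yx-weights)
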